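{- Let $q$ be a prime power and $e,d$ positive integers with $e>d$ and $q>d(2e-d+1)/2$. Let $g\in\mathbb{F}_q[T]$ be monic of degree $e$. With $f$ uniformly distributed over the monic polynomials of degree $d$ in $\mathbb{F}_q[T]$, the expected costs of the Euclidean algorithm on $(g,f)$ satisfy $$\left|\frac{E[t^{\sf div}_g]}{d+1}-1\right|\le\frac{de}{q},\qquad \left|\frac{E[t^{\div}_g]}{e+d+1}-1\right|\le\frac{de}{q},\qquad \left|\frac{E[t^{ -,\times}_g]}{de}-1\right|\le\frac{de}{q}.$$
   Context: Euclidean algorithm on $(g,f)$: set $r_{ -1}=g$, $r_0=f$, and for $i\ge1$, while $r_{i-1}\neq0$, let $r_i$ be the remainder of the division of $r_{i-2}$ by $r_{i-1}$; it stops when a zero remainder is obtained, so it performs divisions $r_{i-2}=q_i r_{i-1}+r_i$, the last one having remainder $0$. Cost model: a polynomial division of a polynomial of degree $m$ by one of degree $n\le m$ (synthetic division) is counted as using $m-n+1$ divisions in $\mathbb{F}_q$ and $n(m-n+1)$ operations of type subtraction/multiplication in $\mathbb{F}_q$. Define $t^{\sf div}_g(f)$ = number of polynomial divisions performed (including the last one), $t^{\div}_g(f)$ = total number of divisions in $\mathbb{F}_q$ over all these polynomial divisions, and $t^{ -,\times}_g(f)$ = total number of subtraction/multiplication operations (i.e. $\sum n(m-n+1)$ over all polynomial divisions). $E$ denotes expectation. -}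

module Defs where

open import Level using (Level) renaming (suc to lsuc)
open import Data.Nat as ℕ using (ℕ; zero; suc; _∸_)
open import Data.Integer using (+_)
import Data.Rational as ℚ
open import Data.Rational using (ℚ)
open import Data.List using (List; []; _∷_; length; map; concatMap)
open import Data.Nat.ListAction using (sum)
open import Data.List.Membership.Propositional using (_∈_)
open import Data.List.Relation.Unary.Unique.Propositional using (Unique)
open import Data.Vec as Vec using (Vec; []; _∷_; toList)
open import Data.Product using (_×_; _,_)
open import Relation.Binary.PropositionalEquality using (_≡_)
open import Relation.Nullary using (¬_; yes; no)
open import Relation.Binary.Definitions using (DecidableEquality)
open import Algebra.Structures using (IsCommutativeRing)

record FiniteField (c : Level) : Set (lsuc c) where
  infixl 7 _*_
  infixl 6 _+_ _-_
  field
    Carrier : Set c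
    _+_ _*_ : Carrier → Carrier → Carrier
    -_      : Carrier → Carrier
    0# 1#   : Carrier
    _⁻¹     : Carrier → Carrier
    isCommutativeRing : IsCommutativeRing _≡_ _+_ _*_ -_ 0# 1#
    0≢1     : ¬ (0# ≡ 1#)
    ⁻¹-inverse : ∀ x → ¬ (x ≡ 0#) → x * (x ⁻¹) ≡ 1#
    _≟_     : DecidableEquality Carrier
    elements : List Carrier
    elements-unique : Unique elements
    elements-complete : ∀ x → x ∈ elements

  _-_ : Carrier → Carrier → Carrier
  x - y = x + (- y)

  size : ℕ
  size = length elements

-- Polynomials over F, represented as big-endian coefficient lists
-- (leading coefficient first).  A list is normalised when its head is
-- nonzero; the zero polynomial is [].

module Poly {c} (F : FiniteField c) where
  open FiniteField F

  Pol : Set c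
  Pol = List Carrier

  normalize : Pol → Pol
  normalize [] = []
  normalize (a ∷ as) with a ≟ 0#
  ... | yes _ = normalize as
  ... | no  _ = a ∷ as

  subPrefix : Pol → List Carrier → Pol
  subPrefix as       []       = as
  subPrefix []       (t ∷ ts) = map (-_) (t ∷ ts)
  subPrefix (a ∷ as) (t ∷ ts) = (a - t) ∷ subPrefix as ts

  -- k steps of synthetic division of a by b (b normalised, nonzero):
  -- each step computes the quotient coefficient t = a₀ b₀⁻¹, subtracts
  -- t·b from the leading part of a and drops the (now zero) leading term.
  divSteps : ℕ → Pol → Pol → Pol
  divSteps zero    b       a        = a
  divSteps (suc k) []      a        = a
  divSteps (suc k) (b ∷ bs) []      = []
  divSteps (suc k) (b ∷ bs) (a ∷ as) =
    divSteps k (b ∷ bs) (subPrefix as (map (λ x → (a * (b ⁻¹)) * x) bs))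

  -- degree of a normalised nonzero polynomial
  deg : Pol → ℕ
  deg p = length p ∸ 1

  rem : Pol → Pol → Pol
  rem a b = normalize (divSteps (suc (deg a ∸ deg b)) b a)

  -- Cost triple: (number of polynomial divisions,
  --               number of divisions in F_q,
  --               number of subtraction/multiplication operations)
  Cost : Set
  Cost = ℕ × ℕ × ℕ

  addCost : Cost → Cost → Cost
  addCost (a , b , c) (a' , b' , c') = (a ℕ.+ a' , b ℕ.+ b' , c ℕ.+ c')

  -- Euclidean algorithm on (r_{i-2}, r_{i-1}) with fuel; the division of
  -- a polynomial of degree m by one of degree n costs 1 polynomial
  -- division, m-n+1 divisions in F_q and n(m-n+1) sub/mul operations.
  -- It stops once the divisor is zero (i.e. after the division with
  -- remainder 0).  Fuel length a + length b + 1 is always sufficient,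
  -- since the degrees strictly decrease.
  euclidFuel : ℕ → Pol → Pol → Cost
  euclidFuel zero     a b       = (0 , 0 , 0)
  euclidFuel (suc fu) a []      = (0 , 0 , 0)
  euclidFuel (suc fu) a (b ∷ bs) =
    addCost (1 , k , deg (b ∷ bs) ℕ.* k) (euclidFuel fu (b ∷ bs) (rem a (b ∷ bs)))
    where k = suc (deg a ∸ deg (b ∷ bs))

  euclid : Pol → Pol → Cost
  euclid g f = euclidFuel (suc (length g ℕ.+ length f)) g f

  tPolDiv tFieldDiv tSubMul : Pol → Pol → ℕ
  tPolDiv   g f with euclid g f
  ... | (a , _ , _) = a
  tFieldDiv g f with euclid g f
  ... | (_ , b , _) = b
  tSubMul   g f with euclid g f
  ... | (_ , _ , c) = c

  -- monic polynomial of degree n with lower coefficients v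
  -- (v lists the coefficients of T^{n-1}, ..., T^0)
  monic : ∀ {n} → Vec Carrier n → Pol
  monic v = 1# ∷ toList v

  allVecs : (n : ℕ) → List (Vec Carrier n)
  allVecs zero    = [] ∷ []
  allVecs (suc n) = concatMap (λ x → map (x ∷_) (allVecs n)) elements

ℕtoℚ : ℕ → ℚ
ℕtoℚ n = + n ℚ./ 1

-- division of a rational by a natural number (convention: by 0 gives 0;
-- never used with 0 under the theorem's hypotheses)
_÷ℕ_ : ℚ → ℕ → ℚ
p ÷ℕ zero  = ℚ.0ℚ
p ÷ℕ suc n = p ℚ.* (+ 1 ℚ./ suc n)

expect : ∀ {a} {A : Set a} → List A → (A → ℕ) → ℚ
expect xs h = ℕtoℚ (sum (map h xs)) ÷ℕ length xs

{-# OPTIONS --safe #-}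
module Submission where

-- Read a coefficient list, leading coefficient first, as a power series in s = 1/T, and write
-- e = d + δ.  A remainder sequence with deg rᵢ = d - i has the cost (d+1, e+d+1, de), and no other
-- sequence costs more, so it suffices to bound the density of the f whose sequence is not of this
-- form.  For such an f there are 1 ≤ j ≤ d and polynomials (u, v) ≠ 0 in s with j and j + δ
-- coefficients such that u g + v f ≡ 0 mod s^(2j+δ), i.e. a vanishing subresultant.
--
-- Partition the monic f of degree d into lines f₀ + x h, x ∈ F_q, with h monic of degree d - 1
-- and generic for g.  For fixed j the bad x on a line are eigenvalues of the pencil
-- v ↦ v f₀ + x v h modulo the multiples of g and s^(2j+δ), which is regular because h is generic;
-- the eigenvectors v are therefore independent and there are at most j + δ of them.  Hence a line has
-- at most Σⱼ (j + δ) = d(2e-d+1)/2 ≤ de bad points.  This number being less than q, generic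
-- polynomials of degree d exist, which in turn supplies h for degree d + 1.

open import Defs
open import Algebra.Bundles using (CommutativeRing)
open import Data.Nat as ℕ using (ℕ; zero; suc; z≤n; s≤s; _∸_)
import Data.Nat.Properties as ℕₚ
open import Data.Nat.ListAction using (sum)
open import Data.Nat.ListAction.Properties using (sum-++; sum-↭)
open import Data.Nat.Solver using (module +-*-Solver)
open import Data.List using (List; []; _∷_; _++_; length; map; filter; concatMap)
open import Data.List.Properties using (map-++; map-∘; length-++; length-map)
open import Data.List.Membership.Propositional using (_∈_; lose; find)
open import Data.List.Membership.Propositional.Properties using (∈-map⁺; ∈-concatMap⁺)
open import Data.List.Membership.Propositional.Properties.WithK using (unique∧set⇒bag)
open import Data.List.Relation.Binary.BagAndSetEquality using (∼bag⇒↭)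
open import Data.List.Relation.Binary.Permutation.Propositional using (_↭_)
open import Data.List.Relation.Binary.Permutation.Propositional.Properties using () renaming (map⁺ to ↭-map⁺)
open import Data.List.Relation.Unary.All as All using (All; []; _∷_)
open import Data.List.Relation.Unary.All.Properties using (all-filter) renaming (filter⁺ to All-filter⁺)
open import Data.List.Relation.Unary.AllPairs using ([]; _∷_)
open import Data.List.Relation.Unary.Any using (here; any?)
open import Data.List.Relation.Unary.Unique.Propositional using (Unique)
open import Data.List.Relation.Unary.Unique.Propositional.Properties using () renaming (map⁺ to Unique-map⁺; filter⁺ to Unique-filter⁺)
open import Data.Vec as Vec using (Vec; []; _∷_; toList; replicate; zipWith)
import Data.Vec.Properties as Vecₚ
open import Data.Product using (_×_; _,_; proj₁; proj₂; ∃; ∃₂)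
open import Data.Empty using (⊥-elim)
open import Function.Base using (_∘_)
open import Function.Bundles using (mk⇔)
open import Relation.Nullary using (¬_; yes; no; Dec; ¬?)
open import Relation.Nullary.Decidable using (map′; _×-dec_; decidable-stable)
open import Relation.Unary using (Decidable)
open import Relation.Binary.PropositionalEquality

-- Arithmetic in a finite field.

module Field {c} (F : FiniteField c) where
  open FiniteField F public
  commutativeRing : CommutativeRing c c
  commutativeRing = record { isCommutativeRing = isCommutativeRing }

  open CommutativeRing commutativeRing public
    using (+-assoc; +-comm; +-identityˡ; +-identityʳ; *-comm; *-identityˡ; *-identityʳ;
           zeroˡ; zeroʳ; -‿inverseˡ; -‿inverseʳ; ring; commutativeSemiring)
  open import Algebra.Properties.Ring ring public
    using (-‿distribˡ-*; +-cancelˡ)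
  open import Algebra.Solver.Ring.NaturalCoefficients.Default commutativeSemiring public
    using (solve; _:=_; _:+_; _:*_)

  *-cancel-zero : ∀ {x y} → ¬ (x ≡ 0#) → x * y ≡ 0# → y ≡ 0#
  *-cancel-zero {x} {y} x≢0 xy≡0 = begin
    y                 ≡⟨ *-identityˡ y ⟨
    1# * y            ≡⟨ cong (_* y) (⁻¹-inverse x x≢0) ⟨
    x * (x ⁻¹) * y    ≡⟨ solve 3 (λ a b c → a :* b :* c := b :* (a :* c)) refl x (x ⁻¹) y ⟩
    (x ⁻¹) * (x * y)  ≡⟨ cong ((x ⁻¹) *_) xy≡0 ⟩
    (x ⁻¹) * 0#       ≡⟨ zeroʳ _ ⟩
    0#                ∎
    where open ≡-Reasoning

  *⁻¹-cancelʳ : ∀ a {b} → ¬ (b ≡ 0#) → a * (b ⁻¹) * b ≡ a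
  *⁻¹-cancelʳ a {b} b≢0 = begin
    a * (b ⁻¹) * b    ≡⟨ solve 3 (λ a b c → a :* c :* b := a :* (b :* c)) refl a b (b ⁻¹) ⟩
    a * (b * (b ⁻¹))  ≡⟨ cong (a *_) (⁻¹-inverse b b≢0) ⟩
    a * 1#            ≡⟨ *-identityʳ a ⟩
    a                 ∎
    where open ≡-Reasoning

  -x*y+y*x : ∀ x y → (- x) * y + y * x ≡ 0#
  -x*y+y*x x y = begin
    (- x) * y + y * x  ≡⟨ solve 3 (λ n x y → n :* y :+ y :* x := y :* (n :+ x)) refl (- x) x y ⟩
    y * (- x + x)      ≡⟨ cong (y *_) (-‿inverseˡ x) ⟩
    y * 0#             ≡⟨ zeroʳ y ⟩
    0#                 ∎
    where open ≡-Reasoning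

  -x+y≢0 : ∀ {x y} → ¬ (x ≡ y) → ¬ (- x + y ≡ 0#)
  -x+y≢0 {x} {y} x≢y eq = x≢y (sym (+-cancelˡ (- x) y x (trans eq (sym (-‿inverseˡ x)))))

-- Independent families in F^n have at most n members.

module LinearAlgebra {c} (F : FiniteField c) where
  open Field F

  0ᵥ : ∀ {n} → Vec Carrier n
  0ᵥ = replicate _ 0#

  _≟ᵥ_ : ∀ {n} (u v : Vec Carrier n) → Dec (u ≡ v)
  _≟ᵥ_ = Vecₚ.≡-dec _≟_

  axpy : ∀ {n} → Carrier → Vec Carrier n → Vec Carrier n → Vec Carrier n
  axpy a = zipWith (λ x y → a * x + y)

  axpy-0# : ∀ {n} (u v : Vec Carrier n) → axpy 0# u v ≡ v
  axpy-0# []      []      = refl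
  axpy-0# (x ∷ u) (y ∷ v) = cong₂ _∷_ (trans (cong (_+ y) (zeroˡ x)) (+-identityˡ y)) (axpy-0# u v)

  axpy-0ᵥ : ∀ {n} a (v : Vec Carrier n) → axpy a 0ᵥ v ≡ v
  axpy-0ᵥ a []      = refl
  axpy-0ᵥ a (y ∷ v) = cong₂ _∷_ (trans (cong (_+ y) (zeroʳ a)) (+-identityˡ y)) (axpy-0ᵥ a v)

  -- The source of two linearity statements: that of `lc` in its coefficients, and that of the
  -- projection in `quotientByLine`.
  axpy-axpy : ∀ {n} c a b (v x y : Vec Carrier n) →
    axpy (c * a + b) v (axpy c x y) ≡ axpy c (axpy a v x) (axpy b v y)
  axpy-axpy c a b []      []      []      = refl
  axpy-axpy c a b (v ∷ vs) (x ∷ xs) (y ∷ ys) = cong₂ _∷_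
    (solve 6 (λ c a b v x y → (c :* a :+ b) :* v :+ (c :* x :+ y) := c :* (a :* v :+ x) :+ (b :* v :+ y))
      refl c a b v x y)
    (axpy-axpy c a b vs xs ys)

  axpy-scale-zero : ∀ {n} a (v : Vec Carrier n) → ¬ (a ≡ 0#) → axpy a v 0ᵥ ≡ 0ᵥ → v ≡ 0ᵥ
  axpy-scale-zero a []      a≢0 eq = refl
  axpy-scale-zero a (x ∷ v) a≢0 eq = cong₂ _∷_
    (*-cancel-zero a≢0 (trans (sym (+-identityʳ _)) (Vecₚ.∷-injectiveˡ eq)))
    (axpy-scale-zero a v a≢0 (Vecₚ.∷-injectiveʳ eq))

  lc : ∀ {n ℓ} → Vec Carrier ℓ → Vec (Vec Carrier n) ℓ → Vec Carrier n
  lc []       []       = 0ᵥ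
  lc (a ∷ as) (v ∷ vs) = axpy a v (lc as vs)

  lc-0ᵥ : ∀ {n ℓ} (vs : Vec (Vec Carrier n) ℓ) → lc 0ᵥ vs ≡ 0ᵥ
  lc-0ᵥ []       = refl
  lc-0ᵥ (v ∷ vs) = trans (axpy-0# v _) (lc-0ᵥ vs)

  lc-axpy : ∀ {n ℓ} c (as bs : Vec Carrier ℓ) (vs : Vec (Vec Carrier n) ℓ) →
    lc (axpy c as bs) vs ≡ axpy c (lc as vs) (lc bs vs)
  lc-axpy c []       []       []       = sym (axpy-0ᵥ c 0ᵥ)
  lc-axpy c (a ∷ as) (b ∷ bs) (v ∷ vs) =
    trans (cong (axpy (c * a + b) v) (lc-axpy c as bs vs)) (axpy-axpy c a b v (lc as vs) (lc bs vs))

  Independent : ∀ {n ℓ} → Vec (Vec Carrier n) ℓ → Set c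
  Independent vs = ∀ as → lc as vs ≡ 0ᵥ → as ≡ 0ᵥ

  head-nonzero : ∀ {n ℓ} (v : Vec Carrier n) (vs : Vec (Vec Carrier n) ℓ) →
    Independent (v ∷ vs) → ¬ (v ≡ 0ᵥ)
  head-nonzero v vs ind refl =
    0≢1 (sym (Vecₚ.∷-injectiveˡ (ind (1# ∷ 0ᵥ) (trans (axpy-0ᵥ 1# _) (lc-0ᵥ vs)))))

  -- A coordinate model of the quotient by the span of v. The kernel condition reads
  -- `axpy a v w ≡ 0ᵥ` because this is how a relation led by v unfolds under `lc`.
  record QuotientByLine {n} (v : Vec Carrier (suc n)) : Set c where
    field
      π      : Vec Carrier (suc n) → Vec Carrier n
      π-0ᵥ   : π 0ᵥ ≡ 0ᵥ
      π-axpy : ∀ a u w → π (axpy a u w) ≡ axpy a (π u) (π w)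
      π-ker  : ∀ w → π w ≡ 0ᵥ → ∃ λ a → axpy a v w ≡ 0ᵥ

  -- Gaussian elimination on the first nonzero coordinate of v: earlier coordinates are kept, that
  -- one is cleared by a multiple of v and dropped.
  quotientByLine : ∀ {n} (v : Vec Carrier (suc n)) → ¬ (v ≡ 0ᵥ) → QuotientByLine v
  quotientByLine (x ∷ v) v≢0 with x ≟ 0#
  quotientByLine {zero} (x ∷ []) v≢0 | yes refl = ⊥-elim (v≢0 refl)
  quotientByLine {suc n} (x ∷ v) v≢0 | yes refl = record
    { π      = λ { (y ∷ w) → y ∷ π w }
    ; π-0ᵥ   = cong (0# ∷_) π-0ᵥ
    ; π-axpy = λ { a (y ∷ u) (z ∷ w) → cong (_ ∷_) (π-axpy a u w) }
    ; π-ker  = λ { (y ∷ w) eq → ker y w (π-ker w (Vecₚ.∷-injectiveʳ eq)) (Vecₚ.∷-injectiveˡ eq) }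
    }
    where
    open QuotientByLine (quotientByLine v (λ eq → v≢0 (cong (0# ∷_) eq)))
    ker : ∀ y w → (∃ λ a → axpy a v w ≡ 0ᵥ) → y ≡ 0# → ∃ λ a → axpy a (0# ∷ v) (y ∷ w) ≡ 0ᵥ
    ker y w (a , eq) y≡0 = a , cong₂ _∷_ (trans (cong₂ _+_ (zeroʳ a) y≡0) (+-identityˡ 0#)) eq
  quotientByLine {n} (x ∷ v) v≢0 | no x≢0 = record
    { π      = proj
    ; π-0ᵥ   = trans (cong (λ z → axpy z v 0ᵥ) (zeroˡ _)) (axpy-0# v 0ᵥ)
    ; π-axpy = linear
    ; π-ker  = λ { (y ∷ w) eq → coef y , cong₂ _∷_ (ker y) eq }
    }
    where
    coef : Carrier → Carrier
    coef y = y * - (x ⁻¹)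
    proj : Vec Carrier (suc n) → Vec Carrier n
    proj (y ∷ w) = axpy (coef y) v w
    linear : ∀ a u w → proj (axpy a u w) ≡ axpy a (proj u) (proj w)
    linear a (y ∷ u) (z ∷ w) = trans
      (cong (λ t → axpy t v (axpy a u w))
        (solve 4 (λ a y z i → (a :* y :+ z) :* i := a :* (y :* i) :+ z :* i) refl a y z (- (x ⁻¹))))
      (axpy-axpy a (coef y) (coef z) v u w)
    ker : ∀ y → coef y * x + y ≡ 0#
    ker y = begin
      y * - (x ⁻¹) * x + y
        ≡⟨ cong (y * - (x ⁻¹) * x +_) (*⁻¹-cancelʳ y x≢0) ⟨
      y * - (x ⁻¹) * x + y * (x ⁻¹) * x
        ≡⟨ solve 4 (λ y n i x → y :* n :* x :+ y :* i :* x := y :* x :* (n :+ i)) refl y (- (x ⁻¹)) (x ⁻¹) x ⟩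
      y * x * (- (x ⁻¹) + (x ⁻¹))
        ≡⟨ cong (y * x *_) (-‿inverseˡ _) ⟩
      y * x * 0#
        ≡⟨ zeroʳ _ ⟩
      0# ∎
      where open ≡-Reasoning

  -- Modulo the line through the first vector the remaining ones stay independent, and the dimension
  -- falls by one.
  independent⇒≤ : ∀ {n ℓ} (vs : Vec (Vec Carrier n) ℓ) → Independent vs → ℓ ℕ.≤ n
  independent⇒≤ []                 ind = z≤n
  independent⇒≤ {zero}  ([] ∷ vs)  ind = ⊥-elim (head-nonzero [] vs ind refl)
  independent⇒≤ {suc n} (v ∷ vs)   ind = s≤s (independent⇒≤ (Vec.map π vs) ind′)
    where
    open QuotientByLine (quotientByLine v (head-nonzero v vs ind))
    π-lc : ∀ {ℓ} as (ws : Vec (Vec Carrier (suc n)) ℓ) → lc as (Vec.map π ws) ≡ π (lc as ws)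
    π-lc []       []       = sym π-0ᵥ
    π-lc (a ∷ as) (w ∷ ws) = trans (cong (axpy a (π w)) (π-lc as ws)) (sym (π-axpy a w (lc as ws)))
    ind′ : Independent (Vec.map π vs)
    ind′ as eq with π-ker (lc as vs) (trans (sym (π-lc as vs)) eq)
    ... | a , eq′ = Vecₚ.∷-injectiveʳ (ind (a ∷ as) eq′)

-- Power series in s, and linear relations between two of them.

module Series {c} (F : FiniteField c) where
  open Field F
  open LinearAlgebra F

  -- Multiplication by s.
  shift : (ℕ → Carrier) → ℕ → Carrier
  shift A zero    = 0#
  shift A (suc i) = A i

  -- u ⊛ A is the product of the series A with the polynomial Σⱼ uⱼ sʲ.
  infixl 7 _⊛_
  _⊛_ : ∀ {n} → Vec Carrier n → (ℕ → Carrier) → ℕ → Carrier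
  ([]      ⊛ A) i = 0#
  ((x ∷ u) ⊛ A) i = x * A i + (u ⊛ shift A) i

  ⊛-0ᵥ : ∀ n A i → (0ᵥ {n} ⊛ A) i ≡ 0#
  ⊛-0ᵥ zero    A i = refl
  ⊛-0ᵥ (suc n) A i = trans (cong₂ _+_ (zeroˡ (A i)) (⊛-0ᵥ n (shift A) i)) (+-identityˡ 0#)

  ⊛-axpyˡ : ∀ {n} a (u v : Vec Carrier n) A i → (axpy a u v ⊛ A) i ≡ a * (u ⊛ A) i + (v ⊛ A) i
  ⊛-axpyˡ a []      []      A i = sym (trans (+-identityʳ _) (zeroʳ a))
  ⊛-axpyˡ a (x ∷ u) (y ∷ v) A i = trans (cong ((a * x + y) * A i +_) (⊛-axpyˡ a u v (shift A) i))
    (solve 6 (λ a x y p U V → (a :* x :+ y) :* p :+ (a :* U :+ V) := a :* (x :* p :+ U) :+ (y :* p :+ V))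
      refl a x y (A i) ((u ⊛ shift A) i) ((v ⊛ shift A) i))

  ⊛-linearʳ : ∀ {n} (u : Vec Carrier n) {A B C} a → (∀ i → C i ≡ A i + a * B i) →
    ∀ i → (u ⊛ C) i ≡ (u ⊛ A) i + a * (u ⊛ B) i
  ⊛-linearʳ []      a eq i = sym (trans (+-identityˡ _) (zeroʳ a))
  ⊛-linearʳ (x ∷ u) {A} {B} {C} a eq i = trans (cong₂ (λ p r → x * p + r) (eq i) (⊛-linearʳ u a eq′ i))
    (solve 6 (λ x p a r U V → x :* (p :+ a :* r) :+ (U :+ a :* V) := x :* p :+ U :+ a :* (x :* r :+ V))
      refl x (A i) a (B i) ((u ⊛ shift A) i) ((u ⊛ shift B) i))
    where
    eq′ : ∀ i → shift C i ≡ shift A i + a * shift B i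
    eq′ zero    = sym (trans (+-identityˡ _) (zeroʳ a))
    eq′ (suc i) = eq i

  ⊛-shift : ∀ {n} (u : Vec Carrier n) A i → (u ⊛ shift A) i ≡ shift (u ⊛ A) i
  ⊛-shift []      A zero    = refl
  ⊛-shift []      A (suc i) = refl
  ⊛-shift (x ∷ u) A zero    =
    trans (cong₂ _+_ (zeroʳ x) (⊛-shift u (shift A) zero)) (+-identityˡ 0#)
  ⊛-shift (x ∷ u) A (suc i) = cong (x * A i +_) (⊛-shift u (shift A) (suc i))

  ⊛-0∷ : ∀ {n} (u : Vec Carrier n) A i → ((0# ∷ u) ⊛ A) i ≡ shift (u ⊛ A) i
  ⊛-0∷ u A i = trans (cong₂ _+_ (zeroˡ (A i)) (⊛-shift u A i)) (+-identityˡ _)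

  -- A series with nonzero constant term is a unit, so it kills no polynomial modulo s^n. The
  -- coefficients of u vanish one after another: the lowest does, then s is divided out.
  ⊛-regular : ∀ {n} (u : Vec Carrier n) A → ¬ (A 0 ≡ 0#) → (∀ {i} → i ℕ.< n → (u ⊛ A) i ≡ 0#) → u ≡ 0ᵥ
  ⊛-regular []      A A₀≢0 h = refl
  ⊛-regular (x ∷ u) A A₀≢0 h = cong₂ _∷_ x≡0
      (⊛-regular u A A₀≢0 (λ {i} i<n → trans (sym (⊛-0∷ u A (suc i)))
        (trans (cong (λ z → ((z ∷ u) ⊛ A) (suc i)) (sym x≡0)) (h (s≤s i<n)))))
    where
    x≡0 : x ≡ 0#
    x≡0 = *-cancel-zero A₀≢0 (begin
      A 0 * x                     ≡⟨ *-comm (A 0) x ⟩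
      x * A 0                     ≡⟨ +-identityʳ _ ⟨
      x * A 0 + 0#                ≡⟨ cong (x * A 0 +_) (⊛-shift u A 0) ⟨
      x * A 0 + (u ⊛ shift A) 0   ≡⟨ h (s≤s z≤n) ⟩
      0#                          ∎)
      where open ≡-Reasoning

  resize : ∀ {m} n → Vec Carrier m → Vec Carrier n
  resize zero    u       = []
  resize (suc n) []      = 0ᵥ
  resize (suc n) (x ∷ u) = x ∷ resize n u

  resize-⊛ : ∀ {m n} → m ℕ.≤ n → (u : Vec Carrier m) → ∀ A i → (resize n u ⊛ A) i ≡ (u ⊛ A) i
  resize-⊛ {n = zero}  z≤n       []      A i = refl
  resize-⊛ {n = suc n} z≤n       []      A i = ⊛-0ᵥ (suc n) A i
  resize-⊛             (s≤s m≤n) (x ∷ u) A i = cong (x * A i +_) (resize-⊛ m≤n u (shift A) i)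

  resize-0ᵥ : ∀ m n → resize n (0ᵥ {m}) ≡ 0ᵥ
  resize-0ᵥ m       zero    = refl
  resize-0ᵥ zero    (suc n) = refl
  resize-0ᵥ (suc m) (suc n) = cong (0# ∷_) (resize-0ᵥ m n)

  -- For series of polynomials A, B with deg A - deg B = n - m this is the vanishing of their subresultant
  -- of index deg B - m.
  record Degenerate (m n : ℕ) (A B : ℕ → Carrier) : Set c where
    constructor degenerate
    field
      u        : Vec Carrier m
      v        : Vec Carrier n
      nonzero  : ¬ (u ≡ 0ᵥ × v ≡ 0ᵥ)
      vanishes : ∀ {i} → i ℕ.< m ℕ.+ n → (u ⊛ A) i + (v ⊛ B) i ≡ 0#

  degenerate-swap : ∀ {m n A B} → Degenerate m n A B → Degenerate n m B A
  degenerate-swap {m} {n} (degenerate u v nz van) = degenerate v u (λ (p , q) → nz (q , p))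
    (λ {i} i< → trans (+-comm _ _) (van (subst (i ℕ.<_) (ℕₚ.+-comm n m) i<)))

  -- With s A′ = A + t B, multiplying u A′ + v B by s gives u A + (t u + s v) B. One order of
  -- vanishing and one coefficient of the second multiplier are gained, and m ≤ n + 1 lets t u fit
  -- there.
  degenerate-step : ∀ {m n A B A′} t → (∀ i → shift A′ i ≡ A i + t * B i) → m ℕ.≤ suc n →
    Degenerate m n A′ B → Degenerate m (suc n) A B
  degenerate-step {m} {n} {A} {B} {A′} t eq m≤1+n (degenerate u v nz van) = degenerate u v′ nz′ van′
    where
    v′ : Vec Carrier (suc n)
    v′ = axpy t (resize (suc n) u) (0# ∷ v)
    nz′ : ¬ (u ≡ 0ᵥ × v′ ≡ 0ᵥ)
    -- For u = 0 the new multiplier is s v, which is zero only if v is.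
    nz′ (refl , eq′) = nz (refl , Vecₚ.∷-injectiveʳ
      (trans (trans (sym (axpy-0ᵥ t _)) (cong (λ w → axpy t w (0# ∷ v)) (sym (resize-0ᵥ m (suc n))))) eq′))
    shifted : ∀ i → (u ⊛ A) i + (v′ ⊛ B) i ≡ shift (u ⊛ A′) i + shift (v ⊛ B) i
    shifted i = begin
      (u ⊛ A) i + (v′ ⊛ B) i
        ≡⟨ cong ((u ⊛ A) i +_) (⊛-axpyˡ t (resize (suc n) u) (0# ∷ v) B i) ⟩
      (u ⊛ A) i + (t * (resize (suc n) u ⊛ B) i + ((0# ∷ v) ⊛ B) i)
        ≡⟨ cong₂ (λ p r → (u ⊛ A) i + (t * p + r)) (resize-⊛ m≤1+n u B i) (⊛-0∷ v B i) ⟩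
      (u ⊛ A) i + (t * (u ⊛ B) i + shift (v ⊛ B) i)
        ≡⟨ +-assoc _ _ _ ⟨
      (u ⊛ A) i + t * (u ⊛ B) i + shift (v ⊛ B) i
        ≡⟨ cong (_+ shift (v ⊛ B) i) (⊛-linearʳ u t eq i) ⟨
      (u ⊛ shift A′) i + shift (v ⊛ B) i
        ≡⟨ cong (_+ shift (v ⊛ B) i) (⊛-shift u A′ i) ⟩
      shift (u ⊛ A′) i + shift (v ⊛ B) i ∎
      where open ≡-Reasoning
    van′ : ∀ {i} → i ℕ.< m ℕ.+ suc n → (u ⊛ A) i + (v′ ⊛ B) i ≡ 0#
    -- The product is a multiple of s, so its constant coefficient vanishes by itself.
    van′ {zero}  _  = trans (shifted zero) (+-identityˡ 0#)
    van′ {suc i} i< = trans (shifted (suc i)) (van (ℕ.s≤s⁻¹ (subst (suc i ℕ.<_) (ℕₚ.+-suc m n) i<)))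

-- Eigenvalues of the pencil A + x B modulo G.

module Pencil {c} (F : FiniteField c) {m n : ℕ} (G A B : ℕ → FiniteField.Carrier F) where
  open Field F
  open LinearAlgebra F
  open Series F

  -- The relation v (A + x B) ≡ - u G modulo s^(m+n): multiplication by A + x B sends v to zero
  -- modulo the multiples of G, with u recording the multiple.
  Vanishing : Carrier → Vec Carrier m → Vec Carrier n → Set c
  Vanishing x u v = ∀ {i} → i ℕ.< m ℕ.+ n → (u ⊛ G) i + (v ⊛ A) i + x * (v ⊛ B) i ≡ 0#

  data Eigenvectors : (xs : List Carrier) → Vec (Vec Carrier m) (length xs) → Vec (Vec Carrier n) (length xs) → Set c where
    []  : Eigenvectors [] [] []
    _∷_ : ∀ {x xs u us v vs} → ¬ (v ≡ 0ᵥ) × Vanishing x u v → Eigenvectors xs us vs → Eigenvectors (x ∷ xs) (u ∷ us) (v ∷ vs)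

  Eigenvalue : Carrier → Set c
  Eigenvalue x = ∃₂ λ u v → ¬ (v ≡ 0ᵥ) × Vanishing x u v

  eigenvectors : ∀ {xs} → All Eigenvalue xs → ∃₂ λ us vs → Eigenvectors xs us vs
  eigenvectors [] = [] , [] , []
  eigenvectors ((u , v , e) ∷ all) with us , vs , es ← eigenvectors all = u ∷ us , v ∷ vs , e ∷ es

  -- The diagonal action of the eigenvalues on coefficients of eigenvectors.
  scale : (xs : List Carrier) → Vec Carrier (length xs) → Vec Carrier (length xs)
  scale []       []       = []
  scale (x ∷ xs) (a ∷ as) = a * x ∷ scale xs as

  -- Summing the eigenvector equations with weights `as` multiplies the weights by the eigenvalues
  -- in the B term only.
  lc-vanishing : ∀ {xs us vs} → Eigenvectors xs us vs → ∀ as {i} → i ℕ.< m ℕ.+ n →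
    (lc as us ⊛ G) i + (lc as vs ⊛ A) i + (lc (scale xs as) vs ⊛ B) i ≡ 0#
  lc-vanishing [] [] {i} _ = trans (cong₂ _+_ (cong₂ _+_ (⊛-0ᵥ m G i) (⊛-0ᵥ n A i)) (⊛-0ᵥ n B i))
    (trans (+-identityʳ _) (+-identityʳ _))
  lc-vanishing {x ∷ xs} {u ∷ us} {v ∷ vs} ((_ , van) ∷ es) (a ∷ as) {i} i< = begin
    (lc (a ∷ as) (u ∷ us) ⊛ G) i + (lc (a ∷ as) (v ∷ vs) ⊛ A) i + (lc (a * x ∷ scale xs as) (v ∷ vs) ⊛ B) i
      ≡⟨ cong₂ _+_ (cong₂ _+_ (⊛-axpyˡ a u _ G i) (⊛-axpyˡ a v _ A i)) (⊛-axpyˡ (a * x) v _ B i) ⟩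
    a * (u ⊛ G) i + (lc as us ⊛ G) i + (a * (v ⊛ A) i + (lc as vs ⊛ A) i) + (a * x * (v ⊛ B) i + (lc (scale xs as) vs ⊛ B) i)
      ≡⟨ solve 8 (λ a x p p′ r r′ s s′ → a :* p :+ p′ :+ (a :* r :+ r′) :+ (a :* x :* s :+ s′)
           := a :* (p :+ r :+ x :* s) :+ (p′ :+ r′ :+ s′))
           refl a x ((u ⊛ G) i) ((lc as us ⊛ G) i) ((v ⊛ A) i) ((lc as vs ⊛ A) i) ((v ⊛ B) i) ((lc (scale xs as) vs ⊛ B) i) ⟩
    a * ((u ⊛ G) i + (v ⊛ A) i + x * (v ⊛ B) i) + ((lc as us ⊛ G) i + (lc as vs ⊛ A) i + (lc (scale xs as) vs ⊛ B) i)
      ≡⟨ cong₂ (λ p r → a * p + r) (van i<) (lc-vanishing es as i<) ⟩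
    a * 0# + 0#
      ≡⟨ trans (+-identityʳ _) (zeroʳ a) ⟩
    0# ∎
    where open ≡-Reasoning

  -- The entries are (y - x) a with y - x invertible.
  shifted-scale-zero : ∀ x xs as → All (λ y → ¬ (x ≡ y)) xs → axpy (- x) as (scale xs as) ≡ 0ᵥ → as ≡ 0ᵥ
  shifted-scale-zero x []       []       []             eq = refl
  shifted-scale-zero x (y ∷ xs) (a ∷ as) (x≢y ∷ x∉xs) eq = cong₂ _∷_
    (*-cancel-zero (-x+y≢0 x≢y)
      (trans (solve 3 (λ n y a → (n :+ y) :* a := n :* a :+ a :* y) refl (- x) y a) (Vecₚ.∷-injectiveˡ eq)))
    (shifted-scale-zero x xs as x∉xs (Vecₚ.∷-injectiveʳ eq))

  module _ (B-regular : ∀ (u : Vec Carrier m) (v : Vec Carrier n) →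
              (∀ {i} → i ℕ.< m ℕ.+ n → (u ⊛ G) i + (v ⊛ B) i ≡ 0#) → v ≡ 0ᵥ) where

    -- A relation among the eigenvectors removes the A term from `lc-vanishing`. What is left is a
    -- multiple of B that vanishes modulo the multiples of G, so regularity of B yields a second
    -- relation, weighted by the eigenvalues.
    scale-zero : ∀ {xs us vs} → Eigenvectors xs us vs → ∀ as → lc as vs ≡ 0ᵥ → lc (scale xs as) vs ≡ 0ᵥ
    scale-zero {xs} {us} {vs} es as eq = B-regular (lc as us) _ λ {i} i< → begin
      (lc as us ⊛ G) i + (lc (scale xs as) vs ⊛ B) i
        ≡⟨ cong (_+ _) (+-identityʳ _) ⟨
      (lc as us ⊛ G) i + 0# + (lc (scale xs as) vs ⊛ B) i
        ≡⟨ cong (λ z → (lc as us ⊛ G) i + z + (lc (scale xs as) vs ⊛ B) i)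
             (trans (cong (λ w → (w ⊛ A) i) eq) (⊛-0ᵥ n A i)) ⟨
      (lc as us ⊛ G) i + (lc as vs ⊛ A) i + (lc (scale xs as) vs ⊛ B) i
        ≡⟨ lc-vanishing es as i< ⟩
      0# ∎
      where open ≡-Reasoning

    -- The classical argument for distinct eigenvalues: the weighted relation minus x times the
    -- original one no longer involves v, so induction kills the tail coefficients, and then a v = 0
    -- with v nonzero.
    eigenvectors-independent : ∀ {xs us vs} → Unique xs → Eigenvectors xs us vs → Independent vs
    eigenvectors-independent []           []          []       eq = refl
    eigenvectors-independent {x ∷ xs} {u ∷ us} {v ∷ vs} (x∉xs ∷ uniq) es@((v≢0 , _) ∷ es′) (a ∷ as) eq =
      cong₂ _∷_ a≡0 as≡0
      where
      tail-relation : lc (axpy (- x) as (scale xs as)) vs ≡ 0ᵥ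
      tail-relation = begin
        lc (axpy (- x) as (scale xs as)) vs
          ≡⟨ axpy-0# v _ ⟨
        axpy 0# v (lc (axpy (- x) as (scale xs as)) vs)
          ≡⟨ cong (λ z → axpy z v (lc (axpy (- x) as (scale xs as)) vs)) (-x*y+y*x x a) ⟨
        lc (axpy (- x) (a ∷ as) (scale (x ∷ xs) (a ∷ as))) (v ∷ vs)
          ≡⟨ lc-axpy (- x) (a ∷ as) (scale (x ∷ xs) (a ∷ as)) (v ∷ vs) ⟩
        axpy (- x) (lc (a ∷ as) (v ∷ vs)) (lc (scale (x ∷ xs) (a ∷ as)) (v ∷ vs))
          ≡⟨ cong₂ (axpy (- x)) eq (scale-zero es (a ∷ as) eq) ⟩
        axpy (- x) 0ᵥ 0ᵥ
          ≡⟨ axpy-0ᵥ (- x) 0ᵥ ⟩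
        0ᵥ ∎
        where open ≡-Reasoning
      as≡0 : as ≡ 0ᵥ
      as≡0 = shifted-scale-zero x xs as x∉xs (eigenvectors-independent uniq es′ _ tail-relation)
      a≡0 : a ≡ 0#
      a≡0 with a ≟ 0#
      ... | yes p = p
      ... | no a≢0 = ⊥-elim (v≢0 (axpy-scale-zero a v a≢0
        (trans (cong (axpy a v) (sym (trans (cong (λ w → lc w vs) as≡0) (lc-0ᵥ vs)))) eq)))

    eigenvalues-≤ : ∀ xs → Unique xs → All Eigenvalue xs → length xs ℕ.≤ n
    eigenvalues-≤ xs uniq all with us , vs , es ← eigenvectors all =
      independent⇒≤ vs (eigenvectors-independent uniq es)

-- Finite sums and counting in lists.

indicator : ∀ {p} {P : Set p} → Dec P → ℕ
indicator (yes _) = 1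
indicator (no _)  = 0

∑< : ℕ → (ℕ → ℕ) → ℕ
∑< zero    b = 0
∑< (suc d) b = ∑< d b ℕ.+ b d

-- With e = d + δ this is d(2e-d+1)/2, the number that the theorem compares with q; see
-- `degenerateBound-double`.
degenerateBound : ℕ → ℕ → ℕ
degenerateBound d δ = ∑< d (λ j → suc j ℕ.+ δ)

degenerateBound-suc : ∀ d δ → degenerateBound d (suc δ) ≡ degenerateBound d δ ℕ.+ d
degenerateBound-suc zero    δ = refl
degenerateBound-suc (suc d) δ = trans (cong (ℕ._+ (suc d ℕ.+ suc δ)) (degenerateBound-suc d δ))
  (solve 3 (λ b d δ → b :+ d :+ (con 1 :+ d :+ (con 1 :+ δ)) := b :+ (con 1 :+ d :+ δ) :+ (con 1 :+ d)) refl
    (degenerateBound d δ) d δ)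
  where open +-*-Solver

-- For the descent from degree d + 1 to degree d with g, hence e, fixed: the gap δ then grows by
-- one.
degenerateBound-mono : ∀ d δ → degenerateBound d (suc δ) ℕ.≤ degenerateBound (suc d) δ
degenerateBound-mono d δ = ℕₚ.≤-trans (ℕₚ.≤-reflexive (degenerateBound-suc d δ))
  (ℕₚ.+-monoʳ-≤ (degenerateBound d δ) (ℕₚ.≤-trans (ℕₚ.n≤1+n d) (ℕₚ.m≤m+n (suc d) δ)))

module _ {a} {A : Set a} where

  ∑ : List A → (A → ℕ) → ℕ
  ∑ xs f = sum (map f xs)

  ∑-cong : ∀ xs {f g : A → ℕ} → (∀ x → f x ≡ g x) → ∑ xs f ≡ ∑ xs g
  ∑-cong []       eq = refl
  ∑-cong (x ∷ xs) eq = cong₂ ℕ._+_ (eq x) (∑-cong xs eq)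

  ∑-mono : ∀ xs {f g : A → ℕ} → (∀ x → f x ℕ.≤ g x) → ∑ xs f ℕ.≤ ∑ xs g
  ∑-mono []       le = z≤n
  ∑-mono (x ∷ xs) le = ℕₚ.+-mono-≤ (le x) (∑-mono xs le)

  ∑-const : ∀ xs k → ∑ xs (λ _ → k) ≡ length xs ℕ.* k
  ∑-const []       k = refl
  ∑-const (x ∷ xs) k = cong (k ℕ.+_) (∑-const xs k)

  ∑-+ : ∀ xs (f g : A → ℕ) → ∑ xs (λ x → f x ℕ.+ g x) ≡ ∑ xs f ℕ.+ ∑ xs g
  ∑-+ []       f g = refl
  ∑-+ (x ∷ xs) f g = trans (cong (f x ℕ.+ g x ℕ.+_) (∑-+ xs f g))
    (solve 4 (λ a b s t → a :+ b :+ (s :+ t) := a :+ s :+ (b :+ t)) refl (f x) (g x) (∑ xs f) (∑ xs g))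
    where open +-*-Solver

  ∑-*ʳ : ∀ xs (f : A → ℕ) k → ∑ xs (λ x → f x ℕ.* k) ≡ ∑ xs f ℕ.* k
  ∑-*ʳ []       f k = refl
  ∑-*ʳ (x ∷ xs) f k = trans (cong (f x ℕ.* k ℕ.+_) (∑-*ʳ xs f k)) (sym (ℕₚ.*-distribʳ-+ k (f x) _))

  module _ {p} {P : A → Set p} (P? : Decidable P) where

    ∑-indicator : ∀ xs → ∑ xs (indicator ∘ P?) ≡ length (filter P? xs)
    ∑-indicator [] = refl
    ∑-indicator (x ∷ xs) with P? x
    ... | yes _ = cong suc (∑-indicator xs)
    ... | no  _ = ∑-indicator xs

    ∑-indicator-all : ∀ {xs} → All P xs → ∑ xs (indicator ∘ P?) ≡ length xs
    ∑-indicator-all [] = refl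
    ∑-indicator-all {x ∷ xs} (px ∷ pxs) with P? x
    ... | yes _  = cong suc (∑-indicator-all pxs)
    ... | no ¬px = ⊥-elim (¬px px)

    filter-complement-length : ∀ xs → length xs ≡ length (filter (¬? ∘ P?) xs) ℕ.+ length (filter P? xs)
    filter-complement-length [] = refl
    filter-complement-length (x ∷ xs) with P? x
    ... | yes _ = trans (cong suc (filter-complement-length xs)) (sym (ℕₚ.+-suc _ _))
    ... | no  _ = cong suc (filter-complement-length xs)

  -- A union bound by induction on d: entries satisfying `P d` are filtered out, and each of the
  -- others has a witness below d.
  unique-union-≤ : ∀ {p} {P : ℕ → A → Set p} → (∀ j → Decidable (P j)) → (b : ℕ → ℕ) → ∀ d →
    (∀ j → j ℕ.< d → ∀ xs → Unique xs → All (P j) xs → length xs ℕ.≤ b j) →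
    ∀ xs → Unique xs → All (λ x → ∃ λ j → j ℕ.< d × P j x) xs → length xs ℕ.≤ ∑< d b
  unique-union-≤ P? b zero    bound []       _ _                     = z≤n
  unique-union-≤ P? b zero    bound (x ∷ xs) _ ((_ , () , _) ∷ _)
  unique-union-≤ {P = P} P? b (suc d) bound xs uniq all = begin
    length xs
      ≡⟨ filter-complement-length (P? d) xs ⟩
    length (filter (¬? ∘ P? d) xs) ℕ.+ length (filter (P? d) xs)
      ≤⟨ ℕₚ.+-mono-≤
          (unique-union-≤ P? b d (λ j j<d → bound j (ℕₚ.m<n⇒m<1+n j<d)) _ (Unique-filter⁺ (¬? ∘ P? d) uniq)
            (All.zipWith lower (All-filter⁺ (¬? ∘ P? d) all , all-filter (¬? ∘ P? d) xs)))
          (bound d ℕₚ.≤-refl _ (Unique-filter⁺ (P? d) uniq) (all-filter (P? d) xs)) ⟩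
    ∑< d b ℕ.+ b d ∎
    where
    open ℕₚ.≤-Reasoning
    lower : ∀ {x} → (∃ λ j → j ℕ.< suc d × P j x) × ¬ P d x → ∃ λ j → j ℕ.< d × P j x
    lower ((j , j<1+d , pj) , ¬pd) =
      j , ℕₚ.≤∧≢⇒< (ℕ.s≤s⁻¹ j<1+d) (λ { refl → ¬pd pj }) , pj

∑-swap : ∀ {a b} {A : Set a} {B : Set b} (xs : List A) (ys : List B) (f : A → B → ℕ) →
  ∑ xs (λ x → ∑ ys (f x)) ≡ ∑ ys (λ y → ∑ xs (λ x → f x y))
∑-swap []       ys f = sym (trans (∑-const ys 0) (ℕₚ.*-zeroʳ (length ys)))
∑-swap (x ∷ xs) ys f = trans (cong (∑ ys (f x) ℕ.+_) (∑-swap xs ys f)) (sym (∑-+ ys (f x) _))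

∑-concatMap : ∀ {a b c} {A : Set a} {B : Set b} {C : Set c} (g : A → B → C) (xs : List A) (ys : List B) (f : C → ℕ) →
  ∑ (concatMap (λ x → map (g x) ys) xs) f ≡ ∑ xs (λ x → ∑ ys (λ y → f (g x y)))
∑-concatMap g []       ys f = refl
∑-concatMap g (x ∷ xs) ys f = begin
  sum (map f (map (g x) ys ++ rest))           ≡⟨ cong sum (map-++ f (map (g x) ys) rest) ⟩
  sum (map f (map (g x) ys) ++ map f rest)     ≡⟨ sum-++ (map f (map (g x) ys)) _ ⟩
  sum (map f (map (g x) ys)) ℕ.+ ∑ rest f      ≡⟨ cong₂ ℕ._+_ (cong sum (map-∘ ys)) (sym (∑-concatMap g xs ys f)) ⟨
  ∑ ys (λ y → f (g x y)) ℕ.+ ∑ xs (λ x → ∑ ys (λ y → f (g x y))) ∎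
  where
  open ≡-Reasoning
  rest = concatMap (λ x → map (g x) ys) xs

-- Enumeration of F^n and invariance of sums under translation.

module Counting {c} (F : FiniteField c) where
  open Field F
  open LinearAlgebra F
  open Poly F using (allVecs)

  1<size : 1 ℕ.< size
  1<size with elements | elements-complete 0# | elements-complete 1#
  ... | x ∷ []     | here p | here r = ⊥-elim (0≢1 (trans p (sym r)))
  ... | x ∷ y ∷ xs | _      | _      = s≤s (s≤s z≤n)

  ∈-allVecs : ∀ {n} (v : Vec Carrier n) → v ∈ allVecs n
  ∈-allVecs []      = here refl
  ∈-allVecs (x ∷ v) = ∈-concatMap⁺ _ (lose (elements-complete x) (∈-map⁺ (x ∷_) (∈-allVecs v)))

  length-allVecs : ∀ n → length (allVecs n) ≡ size ℕ.^ n
  length-allVecs zero    = refl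
  length-allVecs (suc n) = trans (go elements) (cong (size ℕ.*_) (length-allVecs n))
    where
    go : ∀ xs → length (concatMap (λ x → map (Vec._∷_ x) (allVecs n)) xs) ≡ length xs ℕ.* length (allVecs n)
    go []       = refl
    go (x ∷ xs) = trans (length-++ (map (x ∷_) (allVecs n))) (cong₂ ℕ._+_ (length-map (x ∷_) (allVecs n)) (go xs))

  -- Exhaustive search. It makes degeneracy decidable, so that degenerate polynomials can be
  -- counted.
  any-vec? : ∀ {p n} {P : Vec Carrier n → Set p} → Decidable P → Dec (∃ P)
  any-vec? {n = n} P? = map′ (λ p → let v , _ , pv = find p in v , pv) (λ (v , pv) → lose (∈-allVecs v) pv)
    (any? P? (allVecs n))

  -- Both lists are free of repetitions and contain every element of the field.
  elements-translate : ∀ a → map (a +_) elements ↭ elements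
  elements-translate a = ∼bag⇒↭ (unique∧set⇒bag
    (Unique-map⁺ (λ {x} {y} → +-cancelˡ a x y) elements-unique) elements-unique
    (λ {x} → mk⇔ (λ _ → elements-complete x)
      (λ _ → subst (_∈ map (a +_) elements) (cancel x) (∈-map⁺ (a +_) (elements-complete (- a + x))))))
    where
    cancel : ∀ x → a + (- a + x) ≡ x
    cancel x = trans (sym (+-assoc a (- a) x)) (trans (cong (_+ x) (-‿inverseʳ a)) (+-identityˡ x))

  ∑-translate : ∀ a (f : Carrier → ℕ) → ∑ elements (λ x → f (a + x)) ≡ ∑ elements f
  ∑-translate a f = trans (cong sum (map-∘ elements)) (sum-↭ (↭-map⁺ f (elements-translate a)))

  -- Translation by a h permutes F^n, coordinate by coordinate.
  ∑-axpy : ∀ {n} a (h : Vec Carrier n) (f : Vec Carrier n → ℕ) → ∑ (allVecs n) (λ w → f (axpy a h w)) ≡ ∑ (allVecs n) f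
  ∑-axpy a []      f = refl
  ∑-axpy {suc n} a (y ∷ h) f = begin
    ∑ (allVecs (suc n)) (λ w → f (axpy a (y ∷ h) w))
      ≡⟨ ∑-concatMap Vec._∷_ elements (allVecs n) _ ⟩
    ∑ elements (λ x → ∑ (allVecs n) (λ w → f ((a * y + x) ∷ axpy a h w)))
      ≡⟨ ∑-cong elements (λ x → ∑-axpy a h (λ w → f ((a * y + x) ∷ w))) ⟩
    ∑ elements (λ x → ∑ (allVecs n) (λ w → f ((a * y + x) ∷ w)))
      ≡⟨ ∑-translate (a * y) (λ x → ∑ (allVecs n) (λ w → f (x ∷ w))) ⟩
    ∑ elements (λ x → ∑ (allVecs n) (λ w → f (x ∷ w)))
      ≡⟨ ∑-concatMap Vec._∷_ elements (allVecs n) f ⟨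
    ∑ (allVecs (suc n)) f ∎
    where open ≡-Reasoning

-- Counting the degenerate monic polynomials line by line.

module Degeneracy {c} (F : FiniteField c) where
  open Field F hiding (solve; _:=_; _:+_; _:*_)
  open LinearAlgebra F
  open Series F
  open Counting F
  open Poly F using (allVecs; monic)

  -- Read leading coefficient first, a polynomial in T becomes a series in s = 1/T, continued by
  -- zeros.
  coeff : List Carrier → ℕ → Carrier
  coeff []       i       = 0#
  coeff (a ∷ as) zero    = a
  coeff (a ∷ as) (suc i) = coeff as i

  degenerate? : ∀ m n A B → Dec (Degenerate m n A B)
  degenerate? m n A B = map′
    (λ (u , v , witness) → degenerate u v (proj₁ witness) (proj₂ witness))
    (λ (degenerate u v nz van) → u , v , nz , λ {i} → van {i})
    (any-vec? λ u → any-vec? λ v →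
      ¬? ((u ≟ᵥ 0ᵥ) ×-dec (v ≟ᵥ 0ᵥ)) ×-dec ℕₚ.allUpTo? (λ i → ((u ⊛ A) i + (v ⊛ B) i) ≟ 0#) (m ℕ.+ n))

  -- The separate length n′ absorbs the mismatch between (j + 2) + δ and (j + 1) + (δ + 1) in
  -- `shift-regular`.
  nondegenerate⇒0ᵥ : ∀ {m n n′ A B} → n′ ≡ n → ¬ Degenerate m n A B → (u : Vec Carrier m) (v : Vec Carrier n′) →
    (∀ {i} → i ℕ.< m ℕ.+ n → (u ⊛ A) i + (v ⊛ B) i ≡ 0#) → v ≡ 0ᵥ
  nondegenerate⇒0ᵥ refl ¬deg u v van =
    decidable-stable (v ≟ᵥ 0ᵥ) (λ v≢0 → ¬deg (degenerate u v (v≢0 ∘ proj₂) van))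

  DegenerateBelow : ℕ → ℕ → (A B : ℕ → Carrier) → Set c
  DegenerateBelow d δ A B = ∃ λ j → j ℕ.< d × Degenerate (suc j) (suc j ℕ.+ δ) A B

  degenerateBelow? : ∀ d δ A B → Dec (DegenerateBelow d δ A B)
  degenerateBelow? d δ A B = ℕₚ.anyUpTo? (λ j → degenerate? (suc j) (suc j ℕ.+ δ) A B) d

  module Line (G : ℕ → Carrier) (G₀≢0 : ¬ (G 0 ≡ 0#)) {d δ : ℕ} (h : Vec Carrier d)
              (h-generic : ¬ DegenerateBelow d (suc δ) G (coeff (monic h))) (w : Vec Carrier d) where

    H F₀ : ℕ → Carrier
    H  = coeff (monic h)
    -- The second coefficient is free for the parameter x, since x h contributes x in degree d.
    F₀ = coeff (1# ∷ 0# ∷ toList w)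

    point : Carrier → Vec Carrier (suc d)
    point x = x ∷ axpy x h w

    coeff-axpy : ∀ {n} x (h w : Vec Carrier n) i → coeff (toList (axpy x h w)) i ≡ coeff (toList w) i + x * coeff (toList h) i
    coeff-axpy x []      []      i       = sym (trans (+-identityˡ _) (zeroʳ x))
    coeff-axpy x (a ∷ h) (b ∷ w) zero    = +-comm _ _
    coeff-axpy x (a ∷ h) (b ∷ w) (suc i) = coeff-axpy x h w i

    -- The degree of `monic h` is one less than that of the point, hence the factor s when both are
    -- read from the top.
    coeff-point : ∀ x i → coeff (monic (point x)) i ≡ F₀ i + x * shift H i
    coeff-point x zero          = sym (trans (cong (1# +_) (zeroʳ x)) (+-identityʳ 1#))
    coeff-point x (suc zero)    = sym (trans (+-identityˡ _) (*-identityʳ x))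
    coeff-point x (suc (suc i)) = coeff-axpy x h w i

    -- Regularity of the pencil. The constant coefficient forces the first entry of the G multiplier
    -- to vanish. Dividing by s leaves a relation between G and H with one coefficient fewer on the
    -- side of G, which is a degeneracy of h for the gap δ + 1.
    shift-regular : ∀ {j} → j ℕ.< suc d → (u : Vec Carrier (suc j)) (v : Vec Carrier (suc j ℕ.+ δ)) →
      (∀ {i} → i ℕ.< suc j ℕ.+ (suc j ℕ.+ δ) → (u ⊛ G) i + (v ⊛ shift H) i ≡ 0#) → v ≡ 0ᵥ
    shift-regular {j} j<1+d (x ∷ u) v van = conclude j<1+d u v reduced
      where
      open ≡-Reasoning
      x≡0 : x ≡ 0#
      x≡0 = *-cancel-zero G₀≢0 (begin
        G 0 * x
          ≡⟨ *-comm (G 0) x ⟩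
        x * G 0
          ≡⟨ trans (+-identityʳ _) (+-identityʳ _) ⟨
        x * G 0 + 0# + 0#
          ≡⟨ cong₂ (λ p r → x * G 0 + p + r) (⊛-shift u G 0) (⊛-shift v H 0) ⟨
        x * G 0 + (u ⊛ shift G) 0 + (v ⊛ shift H) 0
          ≡⟨ van (s≤s z≤n) ⟩
        0# ∎)
      reduced : ∀ {i} → i ℕ.< j ℕ.+ (suc j ℕ.+ δ) → (u ⊛ G) i + (v ⊛ H) i ≡ 0#
      reduced {i} i< = begin
        (u ⊛ G) i + (v ⊛ H) i
          ≡⟨ cong₂ _+_ (⊛-0∷ u G (suc i)) (⊛-shift v H (suc i)) ⟨
        ((0# ∷ u) ⊛ G) (suc i) + (v ⊛ shift H) (suc i)
          ≡⟨ cong (λ z → ((z ∷ u) ⊛ G) (suc i) + (v ⊛ shift H) (suc i)) x≡0 ⟨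
        ((x ∷ u) ⊛ G) (suc i) + (v ⊛ shift H) (suc i)
          ≡⟨ van (s≤s i<) ⟩
        0# ∎
      conclude : ∀ {j} → j ℕ.< suc d → (u : Vec Carrier j) (v : Vec Carrier (suc j ℕ.+ δ)) →
        (∀ {i} → i ℕ.< j ℕ.+ (suc j ℕ.+ δ) → (u ⊛ G) i + (v ⊛ H) i ≡ 0#) → v ≡ 0ᵥ
      -- No multiple of G is left, and H has constant term 1.
      conclude {zero}  _     [] v red = ⊛-regular v H (0≢1 ∘ sym) (λ i< → trans (sym (+-identityˡ _)) (red i<))
      conclude {suc j} j<1+d u  v red = nondegenerate⇒0ᵥ eq
        (λ deg → h-generic (j , ℕ.s≤s⁻¹ j<1+d , deg)) u v
        (λ {i} i< → red (subst (λ n → i ℕ.< suc j ℕ.+ n) (sym eq) i<))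
        where
        eq : suc (suc j) ℕ.+ δ ≡ suc j ℕ.+ suc δ
        eq = sym (ℕₚ.+-suc (suc j) δ)

    degenerate-points-≤ : ∀ j → j ℕ.< suc d → ∀ xs → Unique xs →
      All (λ x → Degenerate (suc j) (suc j ℕ.+ δ) G (coeff (monic (point x)))) xs → length xs ℕ.≤ suc j ℕ.+ δ
    degenerate-points-≤ j j<1+d xs uniq all =
      eigenvalues-≤ (shift-regular j<1+d) xs uniq (All.map eigenvalue all)
      where
      open Pencil F {suc j} {suc j ℕ.+ δ} G F₀ (shift H)
      eigenvalue : ∀ {x} → Degenerate (suc j) (suc j ℕ.+ δ) G (coeff (monic (point x))) → Eigenvalue x
      eigenvalue {x} (degenerate u v nz van) = u , v , v≢0 , λ {i} i< →
        trans (+-assoc _ _ _) (trans (cong ((u ⊛ G) i +_) (sym (⊛-linearʳ v x (coeff-point x) i))) (van i<))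
        where
        v≢0 : ¬ (v ≡ 0ᵥ)
        -- If v = 0 then u G vanishes to order at least j + 1, and `G 0` is nonzero, so u = 0 as
        -- well.
        v≢0 refl = nz (⊛-regular u G G₀≢0 (λ {i} i< → trans
          (sym (trans (cong ((u ⊛ G) i +_) (⊛-0ᵥ (suc j ℕ.+ δ) _ i)) (+-identityʳ _)))
          (van (ℕₚ.<-≤-trans i< (ℕₚ.m≤m+n (suc j) _)))) , refl)

    line-bound : ∑ elements (λ x → indicator (degenerateBelow? (suc d) δ G (coeff (monic (point x)))))
      ℕ.≤ ∑< (suc d) (λ j → suc j ℕ.+ δ)
    line-bound = begin
      ∑ elements (indicator ∘ bad?)   ≡⟨ ∑-indicator bad? elements ⟩
      length (filter bad? elements)   ≤⟨ unique-union-≤ (λ j x → degenerate? _ _ G (coeff (monic (point x)))) _ (suc d)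
                                          degenerate-points-≤ _ (Unique-filter⁺ bad? elements-unique) (all-filter bad? elements) ⟩
      ∑< (suc d) (λ j → suc j ℕ.+ δ)  ∎
      where
      open ℕₚ.≤-Reasoning
      bad? : Decidable (λ x → DegenerateBelow (suc d) δ G (coeff (monic (point x))))
      bad? x = degenerateBelow? (suc d) δ G (coeff (monic (point x)))

  degenerate-monic? : ∀ G d δ → Decidable (λ (w : Vec Carrier d) → DegenerateBelow d δ G (coeff (monic w)))
  degenerate-monic? G d δ w = degenerateBelow? d δ G (coeff (monic w))

  module _ (G : ℕ → Carrier) (G₀≢0 : ¬ (G 0 ≡ 0#)) where

    -- The density of degenerate polynomials is at most D/q, with denominators cleared. Degree d + 1
    -- is cut into parallel lines whose direction is a generic polynomial of degree d, so the
    -- recursion alternates with `generic-exists`.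
    degenerate-count : ∀ d δ → degenerateBound d δ ℕ.< size →
      ∑ (allVecs d) (indicator ∘ degenerate-monic? G d δ) ℕ.* size ℕ.≤ degenerateBound d δ ℕ.* size ℕ.^ d
    -- If all q^d polynomials were degenerate, the count would give q ≤ D.
    generic-exists : ∀ d δ → degenerateBound d δ ℕ.< size →
      ∃ λ (h : Vec Carrier d) → ¬ DegenerateBelow d δ G (coeff (monic h))

    generic-exists d δ D<q with any-vec? (¬? ∘ degenerate-monic? G d δ)
    ... | yes p = p
    ... | no ¬p = ⊥-elim (ℕₚ.<⇒≱ (ℕₚ.*-monoˡ-< (size ℕ.^ d) {{q^d≢0}} D<q) (begin
        size ℕ.* size ℕ.^ d
          ≡⟨ ℕₚ.*-comm size (size ℕ.^ d) ⟩
        size ℕ.^ d ℕ.* size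
          ≡⟨ cong (ℕ._* size) (length-allVecs d) ⟨
        length (allVecs d) ℕ.* size
          ≡⟨ cong (ℕ._* size) (∑-indicator-all (degenerate-monic? G d δ)
              (All.universal (λ w → decidable-stable (degenerate-monic? G d δ w) (λ ¬b → ¬p (w , ¬b))) (allVecs d))) ⟨
        ∑ (allVecs d) (indicator ∘ degenerate-monic? G d δ) ℕ.* size
          ≤⟨ degenerate-count d δ D<q ⟩
        degenerateBound d δ ℕ.* size ℕ.^ d ∎))
      where
      open ℕₚ.≤-Reasoning
      q^d≢0 : ℕ.NonZero (size ℕ.^ d)
      q^d≢0 = ℕₚ.m^n≢0 size d {{ℕ.>-nonZero (ℕₚ.<⇒≤ 1<size)}}

    degenerate-count zero    δ D<q = z≤n
    degenerate-count (suc d) δ D<q with h , h-generic ← generic-exists d (suc δ) (ℕₚ.≤-<-trans (degenerateBound-mono d δ) D<q) = begin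
        ∑ (allVecs (suc d)) bad ℕ.* size
          ≡⟨ cong (ℕ._* size) (∑-concatMap Vec._∷_ elements (allVecs d) bad) ⟩
        ∑ elements (λ x → ∑ (allVecs d) (λ w → bad (x ∷ w))) ℕ.* size
          -- For each x the vectors w are translated by x h; after the swap of sums, w indexes the
          -- lines and x the points on them.
          ≡⟨ cong (ℕ._* size) (∑-cong elements (λ x → ∑-axpy x h (λ w → bad (x ∷ w)))) ⟨
        ∑ elements (λ x → ∑ (allVecs d) (λ w → bad (x ∷ axpy x h w))) ℕ.* size
          ≡⟨ cong (ℕ._* size) (∑-swap elements (allVecs d) (λ x w → bad (x ∷ axpy x h w))) ⟩
        ∑ (allVecs d) (λ w → ∑ elements (λ x → bad (x ∷ axpy x h w))) ℕ.* size
          ≤⟨ ℕₚ.*-monoˡ-≤ size (∑-mono (allVecs d) (λ w → Line.line-bound G G₀≢0 h h-generic w)) ⟩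
        ∑ (allVecs d) (λ _ → degenerateBound (suc d) δ) ℕ.* size
          ≡⟨ cong (ℕ._* size) (trans (∑-const (allVecs d) _) (cong (ℕ._* degenerateBound (suc d) δ) (length-allVecs d))) ⟩
        size ℕ.^ d ℕ.* degenerateBound (suc d) δ ℕ.* size
          ≡⟨ solve 3 (λ p b q → p :* b :* q := b :* (q :* p)) refl (size ℕ.^ d) (degenerateBound (suc d) δ) size ⟩
        degenerateBound (suc d) δ ℕ.* size ℕ.^ suc d ∎
      where
      open ℕₚ.≤-Reasoning
      open +-*-Solver
      bad = indicator ∘ degenerate-monic? G (suc d) δ

-- Synthetic division and the cost of the Euclidean algorithm.

module Euclid {c} (F : FiniteField c) where
  open Field F hiding (solve; _:=_; _:+_; _:*_)
  open LinearAlgebra F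
  open Series F
  open Degeneracy F
  open Poly F

  subPrefix-length : ∀ as ts → length ts ℕ.≤ length as → length (subPrefix as ts) ≡ length as
  subPrefix-length as       []       _        = refl
  subPrefix-length (a ∷ as) (t ∷ ts) (s≤s le) = cong suc (subPrefix-length as ts le)

  subMultiple-length : ∀ t k as bs → length as ≡ k ℕ.+ length bs →
    length (subPrefix as (map (t *_) bs)) ≡ k ℕ.+ length bs
  subMultiple-length t k as bs eq = trans (subPrefix-length as (map (t *_) bs) (begin
    length (map (t *_) bs)  ≡⟨ length-map (t *_) bs ⟩
    length bs               ≤⟨ ℕₚ.m≤n+m (length bs) k ⟩
    k ℕ.+ length bs         ≡⟨ eq ⟨
    length as               ∎)) eq
    where open ℕₚ.≤-Reasoning

  divSteps-length : ∀ k b bs as → length as ≡ k ℕ.+ length bs → length (divSteps k (b ∷ bs) as) ≡ length bs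
  divSteps-length zero    b bs as       eq = eq
  divSteps-length (suc k) b bs (a ∷ as) eq =
    divSteps-length k b bs _ (subMultiple-length (a * (b ⁻¹)) k as bs (ℕₚ.suc-injective eq))

  coeff-subMultiple : ∀ t as bs i → coeff (subPrefix as (map (t *_) bs)) i ≡ coeff as i + (- t) * coeff bs i
  coeff-subMultiple t as       []       i       = sym (trans (cong (coeff as i +_) (zeroʳ _)) (+-identityʳ _))
  coeff-subMultiple t []       (b ∷ bs) zero    = trans (-‿distribˡ-* t b) (sym (+-identityˡ _))
  coeff-subMultiple t []       (b ∷ bs) (suc i) = trans (go bs i) (sym (+-identityˡ _))
    where
    go : ∀ bs i → coeff (map -_ (map (t *_) bs)) i ≡ (- t) * coeff bs i
    go []       i       = sym (zeroʳ _)
    go (b ∷ bs) zero    = -‿distribˡ-* t b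
    go (b ∷ bs) (suc i) = go bs i
  coeff-subMultiple t (a ∷ as) (b ∷ bs) zero    = cong (a +_) (-‿distribˡ-* t b)
  coeff-subMultiple t (a ∷ as) (b ∷ bs) (suc i) = coeff-subMultiple t as bs i

  -- One step is A′ = (A - t B)/s: t cancels the leading coefficient, and dropping it divides by s.
  divStep-coeff : ∀ {b} → ¬ (b ≡ 0#) → ∀ bs a as i → let t = a * (b ⁻¹) in
    shift (coeff (subPrefix as (map (t *_) bs))) i ≡ coeff (a ∷ as) i + (- t) * coeff (b ∷ bs) i
  divStep-coeff {b} b≢0 bs a as zero = sym (begin
    a + (- (a * (b ⁻¹))) * b  ≡⟨ cong (a +_) (-‿distribˡ-* (a * (b ⁻¹)) b) ⟨
    a + - (a * (b ⁻¹) * b)    ≡⟨ cong (λ z → a + - z) (*⁻¹-cancelʳ a b≢0) ⟩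
    a + - a                   ≡⟨ -‿inverseʳ a ⟩
    0#                        ∎)
    where open ≡-Reasoning
  divStep-coeff {b} b≢0 bs a as (suc i) = coeff-subMultiple (a * (b ⁻¹)) as bs i

  -- Degeneracy of the remainder against the divisor pulls back to the dividend, one coefficient of
  -- v per division step.
  divSteps-degenerate : ∀ {m n b} → ¬ (b ≡ 0#) → m ℕ.≤ suc n → ∀ k bs as → length as ≡ k ℕ.+ length bs →
    Degenerate m n (coeff (divSteps k (b ∷ bs) as)) (coeff (b ∷ bs)) →
    Degenerate m (k ℕ.+ n) (coeff as) (coeff (b ∷ bs))
  divSteps-degenerate b≢0 m≤1+n zero bs as eq deg = deg
  divSteps-degenerate {m} {n} {b} b≢0 m≤1+n (suc k) bs (a ∷ as) eq deg =
    degenerate-step (- (a * (b ⁻¹))) (divStep-coeff b≢0 bs a as)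
      (ℕₚ.≤-trans m≤1+n (s≤s (ℕₚ.m≤n+m n k)))
      (divSteps-degenerate b≢0 m≤1+n k bs _ (subMultiple-length (a * (b ⁻¹)) k as bs (ℕₚ.suc-injective eq)) deg)

  normalize-length : ∀ p → length (normalize p) ℕ.≤ length p
  normalize-length [] = z≤n
  normalize-length (a ∷ p) with a ≟ 0#
  ... | yes _ = ℕₚ.m≤n⇒m≤1+n (normalize-length p)
  ... | no  _ = ℕₚ.≤-refl

  normalize-normal : ∀ {a} p → ¬ (a ≡ 0#) → normalize (a ∷ p) ≡ a ∷ p
  normalize-normal {a} p a≢0 with a ≟ 0#
  ... | yes a≡0 = ⊥-elim (a≢0 a≡0)
  ... | no  _   = refl

  -- The cost for degrees n + δ and n when every nonzero remainder has degree one below its divisor;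
  -- with e = n + δ it is (n + 1, e + n + 1, n e).
  genericCost : ℕ → ℕ → Cost
  genericCost n δ = suc n , n ℕ.+ n ℕ.+ suc δ , n ℕ.* (n ℕ.+ δ)

  _≤ᶜ_ : Cost → Cost → Set
  (a , b , c) ≤ᶜ (a′ , b′ , c′) = a ℕ.≤ a′ × b ℕ.≤ b′ × c ℕ.≤ c′

  -- The divisor has degree m and the remainder degree n = m - 1 - ε. Relative to a drop by one, the
  -- slack is ε in the first two components and m ε in the third.
  genericCost-drop : ∀ n ε δ cost → cost ≤ᶜ genericCost n (suc ε) →
    let m = suc (n ℕ.+ ε) in addCost (1 , suc δ , m ℕ.* suc δ) cost ≤ᶜ genericCost m δ
  genericCost-drop n ε δ (a , b , c) (a≤ , b≤ , c≤) =
      s≤s (ℕₚ.≤-trans a≤ (s≤s (ℕₚ.m≤m+n n ε)))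
    , ℕₚ.≤-trans (ℕₚ.+-monoʳ-≤ (suc δ) b≤) (ℕₚ.m+n≤o⇒m≤o _ {ε} (ℕₚ.≤-reflexive
        (solve 3 (λ n ε δ → con 1 :+ δ :+ (n :+ n :+ (con 2 :+ ε)) :+ ε
          := con 1 :+ (n :+ ε) :+ (con 1 :+ (n :+ ε)) :+ (con 1 :+ δ)) refl n ε δ)))
    , ℕₚ.≤-trans (ℕₚ.+-monoʳ-≤ (suc (n ℕ.+ ε) ℕ.* suc δ) c≤) (ℕₚ.m+n≤o⇒m≤o _ {suc (n ℕ.+ ε) ℕ.* ε} (ℕₚ.≤-reflexive
        (solve 3 (λ n ε δ → let m = con 1 :+ (n :+ ε) in
          m :* (con 1 :+ δ) :+ n :* (n :+ (con 1 :+ ε)) :+ m :* ε := m :* (m :+ δ)) refl n ε δ)))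
    where open +-*-Solver

  genericCost-last : ∀ n δ → addCost (1 , suc δ , n ℕ.* suc δ) (0 , 0 , 0) ≤ᶜ genericCost n δ
  genericCost-last n δ =
      s≤s z≤n
    , ℕₚ.≤-trans (ℕₚ.≤-reflexive (ℕₚ.+-identityʳ (suc δ))) (ℕₚ.m≤n+m (suc δ) (n ℕ.+ n))
    , ℕₚ.≤-trans (ℕₚ.≤-reflexive (ℕₚ.+-identityʳ (n ℕ.* suc δ))) (last n)
    where
    last : ∀ n → n ℕ.* suc δ ℕ.≤ n ℕ.* (n ℕ.+ δ)
    last zero    = z≤n
    last (suc n) = ℕₚ.*-monoʳ-≤ (suc n) (s≤s (ℕₚ.m≤n+m δ n))

  euclidFuel-[] : ∀ fu a → euclidFuel fu a [] ≡ (0 , 0 , 0)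
  euclidFuel-[] zero     a = refl
  euclidFuel-[] (suc fu) a = refl

  degree-drop : ∀ a n δ → length a ≡ suc n ℕ.+ δ → deg a ∸ n ≡ δ
  degree-drop a n δ eq = trans (cong (λ l → l ∸ 1 ∸ n) eq) (ℕₚ.m+n∸m≡n n δ)

  rem-length : ∀ a b bs δ → length a ≡ suc (length bs) ℕ.+ δ → length (rem a (b ∷ bs)) ℕ.≤ length bs
  rem-length a b bs δ eq = ℕₚ.≤-trans (normalize-length (divSteps (suc (deg a ∸ length bs)) (b ∷ bs) a)) (ℕₚ.≤-reflexive
    (divSteps-length (suc (deg a ∸ length bs)) b bs a (begin
      length a                                   ≡⟨ eq ⟩
      suc (length bs ℕ.+ δ)                      ≡⟨ cong suc (ℕₚ.+-comm (length bs) δ) ⟩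
      suc (δ ℕ.+ length bs)                      ≡⟨ cong (λ z → suc (z ℕ.+ length bs)) (degree-drop a (length bs) δ eq) ⟨
      suc (deg a ∸ length bs ℕ.+ length bs)      ∎)))
    where open ≡-Reasoning

  euclidFuel-≤ : ∀ fu a b bs δ → length a ≡ suc (length bs) ℕ.+ δ →
    euclidFuel fu a (b ∷ bs) ≤ᶜ genericCost (length bs) δ
  -- Exhausted fuel costs nothing, so the upper bound holds for any amount of fuel.
  euclidFuel-≤ zero     a b bs δ eq = z≤n , z≤n , z≤n
  euclidFuel-≤ (suc fu) a b bs δ eq
    with rem a (b ∷ bs) | rem-length a b bs δ eq
  ... | [] | _ rewrite degree-drop a (length bs) δ eq | euclidFuel-[] fu (b ∷ bs) = genericCost-last (length bs) δ
  -- Here ε is the excess of the degree drop over one, so the next division has gap ε + 1.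
  ... | r ∷ rs | r<b rewrite degree-drop a (length bs) δ eq with ℕₚ.m≤n⇒∃[o]m+o≡n r<b
  ... | ε , eq′ = subst (λ m → addCost (1 , suc δ , m ℕ.* suc δ) (euclidFuel fu (b ∷ bs) (r ∷ rs)) ≤ᶜ genericCost m δ) eq′
          (genericCost-drop (length rs) ε δ _ (euclidFuel-≤ fu (b ∷ bs) r rs (suc ε)
            (trans (cong suc (sym eq′)) (cong suc (sym (ℕₚ.+-suc (length rs) ε))))))

  genericCost-suc : ∀ n δ → addCost (1 , suc δ , suc n ℕ.* suc δ) (genericCost n 1) ≡ genericCost (suc n) δ
  genericCost-suc n δ = cong (suc (suc n) ,_) (cong₂ _,_
    (solve 2 (λ n δ → con 1 :+ δ :+ (n :+ n :+ con 2) := con 1 :+ n :+ (con 1 :+ n) :+ (con 1 :+ δ)) refl n δ)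
    (solve 2 (λ n δ → (con 1 :+ n) :* (con 1 :+ δ) :+ n :* (n :+ con 1) := (con 1 :+ n) :* (con 1 :+ n :+ δ)) refl n δ))
    where open +-*-Solver

  -- Either failure would lift through the division to a degeneracy of the original pair, so the
  -- remainder has full length and the next pair, of gap 1, is again generic.
  remainder-nondegenerate : ∀ {n δ b} → ¬ (b ≡ 0#) → ∀ bs a → length a ≡ suc δ ℕ.+ length bs →
    ¬ DegenerateBelow (suc n) δ (coeff a) (coeff (b ∷ bs)) → let R = coeff (divSteps (suc δ) (b ∷ bs) a) in
    ¬ (R 0 ≡ 0#) × ¬ DegenerateBelow n 1 (coeff (b ∷ bs)) R
  remainder-nondegenerate {n} {δ} {b} b≢0 bs a eq ¬deg = head≢0 , nondegenerate
    where
    R : ℕ → Carrier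
    R = coeff (divSteps (suc δ) (b ∷ bs) a)
    lift : ∀ {j} → j ℕ.< suc n → Degenerate (suc j) j R (coeff (b ∷ bs)) →
      DegenerateBelow (suc n) δ (coeff a) (coeff (b ∷ bs))
    lift {j} j<1+n deg = j , j<1+n ,
      subst (λ k → Degenerate (suc j) k (coeff a) (coeff (b ∷ bs))) (cong suc (ℕₚ.+-comm δ j))
        (divSteps-degenerate b≢0 ℕₚ.≤-refl (suc δ) bs a eq deg)
    head≢0 : ¬ (R 0 ≡ 0#)
    -- A vanishing leading coefficient is the relation 1 · R ≡ 0 modulo s; it lifts to index j = 0.
    head≢0 R₀≡0 = ¬deg (lift (s≤s z≤n) (degenerate (1# ∷ []) [] (λ (p , _) → 0≢1 (sym (Vecₚ.∷-injectiveˡ p))) van))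
      where
      van : ∀ {i} → i ℕ.< 1 → ((1# ∷ []) ⊛ R) i + ([] ⊛ coeff (b ∷ bs)) i ≡ 0#
      van (s≤s z≤n) = trans (+-identityʳ _) (trans (+-identityʳ _) (trans (*-identityˡ _) R₀≡0))
    nondegenerate : ¬ DegenerateBelow n 1 (coeff (b ∷ bs)) R
    -- Exchanging the two series makes R the dividend side; the lift raises the index from j to j +
    -- 1.
    nondegenerate (j , j<n , deg) = ¬deg (lift (s≤s j<n)
      (subst (λ k → Degenerate k (suc j) R (coeff (b ∷ bs))) (ℕₚ.+-comm (suc j) 1) (degenerate-swap deg)))

  euclidFuel-generic : ∀ n fu a {b} bs δ → n ℕ.< fu → length bs ≡ n → length a ≡ suc δ ℕ.+ n → ¬ (b ≡ 0#) →
    ¬ DegenerateBelow n δ (coeff a) (coeff (b ∷ bs)) → euclidFuel fu a (b ∷ bs) ≡ genericCost n δ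
  euclidFuel-generic n (suc fu) a {b} bs δ (s≤s n≤fu) refl eqₐ b≢0 ¬deg
    rewrite degree-drop a (length bs) δ (trans eqₐ (cong suc (ℕₚ.+-comm δ (length bs))))
    -- The nondegeneracy facts are abstracted along with the remainder, and for every n, because n
    -- is seen to be a successor only once `bs` is split.
    with divSteps (suc δ) (b ∷ bs) a | divSteps-length (suc δ) b bs a eqₐ
       | (λ n → remainder-nondegenerate {n} b≢0 bs a eqₐ)
  euclidFuel-generic .0 (suc fu) a {b} [] δ _ refl eqₐ b≢0 ¬deg | [] | _ | _
    rewrite euclidFuel-[] fu (b ∷ []) | ℕₚ.+-identityʳ δ = refl
  euclidFuel-generic .(suc (length bs)) (suc fu) a {b} (b′ ∷ bs) δ (s≤s n≤fu) refl eqₐ b≢0 ¬deg | r ∷ rs | len | nondeg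
    with r≢0 , ¬deg′ ← nondeg (length bs) ¬deg
    rewrite normalize-normal rs r≢0
          | euclidFuel-generic (length bs) fu (b ∷ b′ ∷ bs) rs 1 n≤fu (ℕₚ.suc-injective len) refl r≢0 ¬deg′
    = genericCost-suc (length bs) δ

-- From natural number counts to bounds on rational ratios.

open import Data.Nat using (_+_; _*_; _<_)
open import Data.Integer as ℤ using (+_)
import Data.Integer.Properties as ℤₚ
open import Data.Rational as ℚ using (ℚ; ∣_∣; _≤_; _-_; 1ℚ; toℚᵘ)
import Data.Rational.Properties as ℚₚ
open import Data.Rational.Unnormalised as ℚᵘ using (mkℚᵘ; 1ℚᵘ; *≤*)
import Data.Rational.Unnormalised.Properties as ℚᵘₚ

-- `mkℚᵘ` stores denominators less one: n + k(n + 1) is the predecessor of (k + 1)(n + 1).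
toℚᵘ-÷ℕ : ∀ {p a k} n → toℚᵘ p ℚᵘ.≃ mkℚᵘ a k → toℚᵘ (p ÷ℕ suc n) ℚᵘ.≃ mkℚᵘ a (n + k * suc n)
toℚᵘ-÷ℕ {p} {a} {k} n p≃ = begin
  toℚᵘ (p ℚ.* (+ 1 ℚ./ suc n))           ≈⟨ ℚₚ.toℚᵘ-homo-* p (+ 1 ℚ./ suc n) ⟩
  toℚᵘ p ℚᵘ.* toℚᵘ (+ 1 ℚ./ suc n)       ≈⟨ ℚᵘₚ.*-cong p≃ (ℚₚ.toℚᵘ-fromℚᵘ (mkℚᵘ (+ 1) n)) ⟩
  mkℚᵘ (a ℤ.* + 1) (n + k * suc n)       ≡⟨ cong (λ z → mkℚᵘ z (n + k * suc n)) (ℤₚ.*-identityʳ a) ⟩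
  mkℚᵘ a (n + k * suc n)                 ∎
  where open import Relation.Binary.Reasoning.Setoid ℚᵘₚ.≃-setoid

-- As S ≤ K = k + 1, the absolute value is (K - S)/K, and the second hypothesis bounds K - S after
-- cross multiplication. Here q too is one less than the denominator it stands for.
∣S/K-1∣≤M/q : ∀ S k M q → S ℕ.≤ suc k → suc k * suc q ℕ.≤ S * suc q + M * suc k →
  ℚᵘ.∣ mkℚᵘ (+ S) k ℚᵘ.- 1ℚᵘ ∣ ℚᵘ.≤ mkℚᵘ (+ M) q
∣S/K-1∣≤M/q S k M q S≤K le = *≤* (begin
  + ℤ.∣ + S ℤ.* + 1 ℤ.+ ℤ.- (+ 1) ℤ.* + suc k ∣ ℤ.* + suc q
    ≡⟨ cong (λ z → + z ℤ.* + suc q) abs ⟩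
  + (suc k ∸ S) ℤ.* + suc q
    ≡⟨ ℤₚ.pos-* (suc k ∸ S) (suc q) ⟨
  + ((suc k ∸ S) * suc q)
    ≤⟨ ℤ.+≤+ (ℕₚ.≤-trans (ℕₚ.≤-reflexive (ℕₚ.*-distribʳ-∸ (suc q) (suc k) S)) (ℕₚ.m≤n+o⇒m∸n≤o _ (S * suc q) le)) ⟩
  + (M * suc k)
    ≡⟨ cong (λ z → + (M * z)) (ℕₚ.*-identityʳ (suc k)) ⟨
  + (M * (suc k * 1))
    ≡⟨ ℤₚ.pos-* M (suc k * 1) ⟩
  + M ℤ.* + (suc k * 1) ∎)
  where
  open ℤₚ.≤-Reasoning
  abs : ℤ.∣ + S ℤ.* + 1 ℤ.+ ℤ.- (+ 1) ℤ.* + suc k ∣ ≡ suc k ∸ S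
  abs = trans (cong ℤ.∣_∣ (trans (cong₂ ℤ._+_ (ℤₚ.*-identityʳ (+ S)) (ℤₚ.-1*i≡-i (+ suc k))) (ℤₚ.m-n≡m⊖n S (suc k))))
    (ℤₚ.∣⊖∣-≤ S≤K)

mean-ratio-≤ : ∀ S N C M q → 0 < N → 0 < C → 0 < q →
  S ℕ.≤ N * C → N * C * q ℕ.≤ S * q + M * (N * C) →
  ∣ ((ℕtoℚ S ÷ℕ N) ÷ℕ C) - 1ℚ ∣ ≤ ℕtoℚ M ÷ℕ q
mean-ratio-≤ S (suc n) (suc c) M (suc q) _ _ _ S≤ le = ℚₚ.toℚᵘ-cancel-≤ (begin
  toℚᵘ ∣ x - 1ℚ ∣
    ≃⟨ ℚₚ.toℚᵘ-homo-∣-∣ (x - 1ℚ) ⟩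
  ℚᵘ.∣ toℚᵘ (x - 1ℚ) ∣
    ≃⟨ ℚᵘₚ.∣-∣-cong (ℚᵘₚ.≃-trans (ℚₚ.toℚᵘ-homo-+ x (ℚ.- 1ℚ)) (ℚᵘₚ.+-cong x≃ ℚᵘₚ.≃-refl)) ⟩
  ℚᵘ.∣ mkℚᵘ (+ S) (c + n * suc c) ℚᵘ.- 1ℚᵘ ∣
    ≤⟨ ∣S/K-1∣≤M/q S (c + n * suc c) M q S≤ le ⟩
  mkℚᵘ (+ M) q
    ≃⟨ bound≃ ⟨
  toℚᵘ (ℕtoℚ M ÷ℕ suc q) ∎)
  where
  open ℚᵘₚ.≤-Reasoning
  x = (ℕtoℚ S ÷ℕ suc n) ÷ℕ suc c
  ℕtoℚ≃ : ∀ m k → toℚᵘ (ℕtoℚ m ÷ℕ suc k) ℚᵘ.≃ mkℚᵘ (+ m) k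
  ℕtoℚ≃ m k = ℚᵘₚ.≃-trans (toℚᵘ-÷ℕ {ℕtoℚ m} k (ℚₚ.toℚᵘ-fromℚᵘ (mkℚᵘ (+ m) 0)))
    (ℚᵘₚ.≃-reflexive (cong (mkℚᵘ (+ m)) (ℕₚ.+-identityʳ k)))
  x≃ : toℚᵘ x ℚᵘ.≃ mkℚᵘ (+ S) (c + n * suc c)
  x≃ = toℚᵘ-÷ℕ {ℕtoℚ S ÷ℕ suc n} c (ℕtoℚ≃ S n)
  bound≃ : toℚᵘ (ℕtoℚ M ÷ℕ suc q) ℚᵘ.≃ mkℚᵘ (+ M) q
  bound≃ = ℕtoℚ≃ M q

-- Each x satisfying P loses at most C and the others lose nothing, so the mean over C is at least 1
-- minus the density of P, and that density is at most M/q.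
expect-ratio-≤ : ∀ {a p} {A : Set a} {P : A → Set p} (P? : Decidable P) (xs : List A) (t : A → ℕ) C M q →
  0 < length xs → 0 < C → 0 < q →
  (∀ x → t x ℕ.≤ C) → (∀ x → ¬ P x → t x ≡ C) → ∑ xs (indicator ∘ P?) * q ℕ.≤ M * length xs →
  ∣ (expect xs t ÷ℕ C) - 1ℚ ∣ ≤ ℕtoℚ M ÷ℕ q
expect-ratio-≤ P? xs t C M q 0<N 0<C 0<q t≤C t≡C bad≤ = mean-ratio-≤ (∑ xs t) N C M q 0<N 0<C 0<q
  (ℕₚ.≤-trans (∑-mono xs t≤C) (ℕₚ.≤-reflexive (∑-const xs C)))
  (begin
    N * C * q
      ≡⟨ cong (_* q) (∑-const xs C) ⟨
    ∑ xs (λ _ → C) * q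
      ≤⟨ ℕₚ.*-monoˡ-≤ q (∑-mono xs pointwise) ⟩
    ∑ xs (λ x → t x + indicator (P? x) * C) * q
      ≡⟨ cong (_* q) (trans (∑-+ xs t _) (cong (λ z → ∑ xs t + z) (∑-*ʳ xs (indicator ∘ P?) C))) ⟩
    (∑ xs t + B * C) * q
      ≡⟨ solve 4 (λ s b c q → (s :+ b :* c) :* q := s :* q :+ b :* q :* c) refl (∑ xs t) B C q ⟩
    ∑ xs t * q + B * q * C
      ≤⟨ ℕₚ.+-monoʳ-≤ (∑ xs t * q) (ℕₚ.*-monoˡ-≤ C bad≤) ⟩
    ∑ xs t * q + M * N * C
      ≡⟨ cong (λ z → ∑ xs t * q + z) (ℕₚ.*-assoc M N C) ⟩
    ∑ xs t * q + M * (N * C) ∎)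
  where
  open ℕₚ.≤-Reasoning
  open +-*-Solver
  N = length xs
  B = ∑ xs (indicator ∘ P?)
  pointwise : ∀ x → C ℕ.≤ t x + indicator (P? x) * C
  pointwise x with P? x
  ... | yes _ = ℕₚ.≤-trans (ℕₚ.≤-reflexive (sym (ℕₚ.*-identityˡ C))) (ℕₚ.m≤n+m (1 * C) (t x))
  ... | no ¬p = ℕₚ.≤-reflexive (trans (sym (t≡C x ¬p)) (sym (ℕₚ.+-identityʳ (t x))))

-- The closed form 2D = d(2e + 1) - d², arranged without subtraction to match the hypothesis on q.
degenerateBound-double : ∀ d δ → 2 * degenerateBound d δ + d * d ≡ d * (d + δ + (d + δ) + 1)
degenerateBound-double zero    δ = refl
degenerateBound-double (suc d) δ = begin
  2 * (b + (suc d + δ)) + suc d * suc d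
    ≡⟨ solve 3 (λ b d δ → con 2 :* (b :+ (con 1 :+ d :+ δ)) :+ (con 1 :+ d) :* (con 1 :+ d)
         := (con 2 :* b :+ d :* d) :+ (con 2 :* (con 1 :+ d :+ δ) :+ (con 2 :* d :+ con 1))) refl b d δ ⟩
  2 * b + d * d + (2 * (1 + d + δ) + (2 * d + 1))
    ≡⟨ cong (_+ (2 * (1 + d + δ) + (2 * d + 1))) (degenerateBound-double d δ) ⟩
  d * (d + δ + (d + δ) + 1) + (2 * (1 + d + δ) + (2 * d + 1))
    ≡⟨ solve 2 (λ d δ → d :* (d :+ δ :+ (d :+ δ) :+ con 1) :+ (con 2 :* (con 1 :+ d :+ δ) :+ (con 2 :* d :+ con 1))
         := (con 1 :+ d) :* (con 1 :+ d :+ δ :+ (con 1 :+ d :+ δ) :+ con 1)) refl d δ ⟩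
  suc d * (suc d + δ + (suc d + δ) + 1) ∎
  where
  open ≡-Reasoning
  open +-*-Solver
  b = degenerateBound d δ

degenerateBound-≤ : ∀ d δ → degenerateBound d δ ℕ.≤ d * (d + δ)
degenerateBound-≤ zero    δ = z≤n
degenerateBound-≤ (suc d) δ = begin
  degenerateBound d δ + (suc d + δ)  ≤⟨ ℕₚ.+-monoˡ-≤ (suc d + δ) (degenerateBound-≤ d δ) ⟩
  d * (d + δ) + (suc d + δ)          ≤⟨ ℕₚ.+-monoˡ-≤ (suc d + δ) (ℕₚ.*-monoʳ-≤ d (ℕₚ.n≤1+n (d + δ))) ⟩
  d * (suc d + δ) + (suc d + δ)      ≡⟨ ℕₚ.+-comm (d * (suc d + δ)) (suc d + δ) ⟩
  suc d * (suc d + δ)                ∎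
  where open ℕₚ.≤-Reasoning

-- The expected costs for a fixed g.

module EuclidCost {c} (F : FiniteField c) {d δ : ℕ} (g : Vec (FiniteField.Carrier F) (d + δ)) where
  open FiniteField F using (Carrier; 1#; 0≢1)
  open Degeneracy F
  open Euclid F
  open Poly F

  length-monic : (f : Vec Carrier d) → length (monic g) ≡ suc (length (toList f)) + δ
  length-monic f = cong suc (trans (Vecₚ.length-toList g) (cong (_+ δ) (sym (Vecₚ.length-toList f))))

  euclid-≤ : ∀ f → euclid (monic g) (monic f) ≤ᶜ genericCost d δ
  euclid-≤ f = subst (λ n → euclid (monic g) (monic f) ≤ᶜ genericCost n δ) (Vecₚ.length-toList f)
    (euclidFuel-≤ (suc (length (monic g) + length (monic f))) (monic g) 1# (toList f) δ (length-monic f))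

  euclid-generic : ∀ f → ¬ DegenerateBelow d δ (coeff (monic g)) (coeff (monic f)) →
    euclid (monic g) (monic f) ≡ genericCost d δ
  euclid-generic f = euclidFuel-generic d _ (monic g) (toList f) δ fuel (Vecₚ.length-toList f)
    (cong suc (trans (Vecₚ.length-toList g) (ℕₚ.+-comm d δ))) (0≢1 ∘ sym)
    where
    open ℕₚ.≤-Reasoning
    fuel : d < suc (length (monic g) + length (monic f))
    fuel = begin-strict
      d                                           ≡⟨ Vecₚ.length-toList f ⟨
      length (toList f)                           <⟨ ℕₚ.≤-refl ⟩
      length (monic f)                            ≤⟨ ℕₚ.m≤n+m _ (length (monic g)) ⟩
      length (monic g) + length (monic f)         <⟨ ℕₚ.≤-refl ⟩
      suc (length (monic g) + length (monic f))   ∎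

  tPolDiv≡ : ∀ (f : Vec Carrier d) → tPolDiv (monic g) (monic f) ≡ proj₁ (euclid (monic g) (monic f))
  tPolDiv≡ f with euclid (monic g) (monic f)
  ... | _ = refl

  tFieldDiv≡ : ∀ (f : Vec Carrier d) → tFieldDiv (monic g) (monic f) ≡ proj₁ (proj₂ (euclid (monic g) (monic f)))
  tFieldDiv≡ f with euclid (monic g) (monic f)
  ... | _ = refl

  tSubMul≡ : ∀ (f : Vec Carrier d) → tSubMul (monic g) (monic f) ≡ proj₂ (proj₂ (euclid (monic g) (monic f)))
  tSubMul≡ f with euclid (monic g) (monic f)
  ... | _ = refl

  module _ (D<q : degenerateBound d δ < FiniteField.size F) where
    open Counting F
    open FiniteField F using (size)
    G : ℕ → Carrier
    G = coeff (monic g)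

    G₀≢0 : ¬ (G 0 ≡ FiniteField.0# F)
    G₀≢0 = 0≢1 ∘ sym

    -- All three inequalities at once: π selects a component of the cost, and C is its generic
    -- value.
    cost-ratio : ∀ (t : Vec Carrier d → ℕ) (π : Cost → ℕ) C →
      (∀ f → t f ≡ π (euclid (monic g) (monic f))) →
      (∀ {cost} → cost ≤ᶜ genericCost d δ → π cost ℕ.≤ C) → π (genericCost d δ) ≡ C → 0 < C →
      ∣ (expect (allVecs d) t ÷ℕ C) - 1ℚ ∣ ≤ ℕtoℚ (d * (d + δ)) ÷ℕ size
    cost-ratio t π C t≡ π≤ π≡ 0<C = expect-ratio-≤ (degenerate-monic? G d δ) (allVecs d) t C (d * (d + δ)) size
      (subst (0 <_) (sym (length-allVecs d)) (ℕₚ.m^n>0 size {{ℕ.>-nonZero 0<q}} d)) 0<C 0<q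
      (λ f → subst (ℕ._≤ C) (sym (t≡ f)) (π≤ (euclid-≤ f)))
      (λ f ¬bad → trans (t≡ f) (trans (cong π (euclid-generic f ¬bad)) π≡))
      -- The density of degenerate f is at most D/q, and D ≤ d e.
      (ℕₚ.≤-trans (degenerate-count G G₀≢0 d δ D<q)
        (ℕₚ.≤-trans (ℕₚ.*-monoˡ-≤ (size ℕ.^ d) (degenerateBound-≤ d δ))
          (ℕₚ.≤-reflexive (cong (d * (d + δ) *_) (sym (length-allVecs d))))))
      where
      0<q : 0 < size
      0<q = ℕₚ.<⇒≤ 1<size

theorem5p4 : ∀ {c} (F : FiniteField c) (e d : ℕ) → 0 < d → d < e →
    let open Poly F in
    let q = FiniteField.size F in
    -- q > d(2e-d+1)/2, stated without division: 2q > d(2e+1-d)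
    d * (e + e + 1) < 2 * q + d * d →
    (g : Vec (FiniteField.Carrier F) e) →
    let fs = allVecs d in
    let bound = ℕtoℚ (d * e) ÷ℕ q in
    (∣ (expect fs (λ f → tPolDiv (monic g) (monic f)) ÷ℕ (d + 1)) - 1ℚ ∣ ≤ bound)
    × (∣ (expect fs (λ f → tFieldDiv (monic g) (monic f)) ÷ℕ (e + d + 1)) - 1ℚ ∣ ≤ bound)
    × (∣ (expect fs (λ f → tSubMul (monic g) (monic f)) ÷ℕ (d * e)) - 1ℚ ∣ ≤ bound)
theorem5p4 F e d 0<d d<e small g with ℕₚ.m≤n⇒∃[o]m+o≡n (ℕₚ.<⇒≤ d<e)
... | δ , refl =
    cost-ratio′ _ proj₁ (d + 1) tPolDiv≡ (λ le → ℕₚ.≤-trans (proj₁ le) (ℕₚ.≤-reflexive (ℕₚ.+-comm 1 d)))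
      (ℕₚ.+-comm 1 d) (ℕₚ.m≤n+m 1 d)
  , cost-ratio′ _ (proj₁ ∘ proj₂) (d + δ + d + 1) tFieldDiv≡
      (λ le → ℕₚ.≤-trans (proj₁ (proj₂ le)) (ℕₚ.≤-reflexive fieldDiv≡)) fieldDiv≡ (ℕₚ.m≤n+m 1 (d + δ + d))
  , cost-ratio′ _ (proj₂ ∘ proj₂) (d * (d + δ)) tSubMul≡ (proj₂ ∘ proj₂) refl
      (ℕₚ.*-mono-≤ 0<d (ℕₚ.≤-trans 0<d (ℕₚ.m≤m+n d δ)))
  where
  open EuclidCost F {d} {δ} g
  open +-*-Solver
  q = FiniteField.size F
  D<q : degenerateBound d δ < q
  -- The hypothesis on q is 2D + d² < 2q + d²; cancel d², then 2.
  D<q = ℕₚ.*-cancelˡ-< 2 _ _ (ℕₚ.+-cancelʳ-< (d * d) _ _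
    (subst (_< 2 * q + d * d) (sym (degenerateBound-double d δ)) small))
  cost-ratio′ = cost-ratio D<q
  fieldDiv≡ : d + d + suc δ ≡ d + δ + d + 1
  fieldDiv≡ = solve 2 (λ d δ → d :+ d :+ (con 1 :+ δ) := d :+ δ :+ d :+ con 1) refl d δ
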